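{- Let $n\geqslant 7$ and let $\dot G=(G,\sigma)$ be an unbalanced signed graph of order $n$ that is $\mathcal{K}_4^-$-free. Then the number of edges satisfies $$e(\dot G)\leqslant \frac{n(n-1)}{2}-(n-3),$$ with equality if and only if $\dot G$ is switching equivalent (up to isomorphism) to a signed graph in the family $$\mathcal{G}=\big\{\dot G_1(a,b),\ \dot G_1'(1,n-4),\ \dot G_2(c,d),\ \dot G_3(1,n-5),\ \dot G_4(1,n-5),\ \dot G_5(1,n-5)\big\},$$ where $(a,b)$ ranges over all pairs of integers with $a+b=n-3$, $a,b\geqslant 0$, and $(c,d)$ ranges over all pairs of integers with $c+d=n-4$, $c,d\geqslant 1$.
   Context: All graphs are finite, simple and undirected. A signed graph $\dot G=(G,\sigma)$ consists of a graph $G$ (the underlying graph) and a sign function $\sigma:E(G)\to\{ -1,+1\}$; its order and its number of edges $e(\dot G)$ are those of $G$. The sign of a cycle is the product of the signs of its edges; a cycle is positive or negative accordingly. $\dot G$ is balanced if all its cycles are positive, and unbalanced otherwise. For $U\subseteq V(G)$, $\dot G_U$ is obtained from $\dot G$ by reversing the sign of every edge between $U$ and $V(G)\setminus U$; $\dot G_U$ is called switching equivalent to $\dot G$, written $\dot G\sim\dot G_U$ (statements $\dot G\sim\dot H$ are understood up to sign-preserving isomorphism of signed graphs). $\mathcal{K}_4^-$ is the set of all unbalanced signed graphs whose underlying graph is $K_4$; $\dot G$ is $\mathcal{K}_4^-$-free if it contains no member of $\mathcal{K}_4^-$ as a (signed) subgraph. The signed graphs in $\mathcal{G}$, all of order $n$,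 are as follows. $\dot G_1(a,b)$, $a+b=n-3$: the vertex set is $\{u,v,w\}\cup A\cup B$ (disjoint), $|A|=a$, $|B|=b$. All pairs of vertices are adjacent except that $u$ is not adjacent to any vertex of $B$ and $v$ is not adjacent to any vertex of $A$. The edge $uv$ is negative and all other edges are positive. $\dot G_1'(1,n-4)$: same underlying graph as $\dot G_1(1,n-4)$, with $A=\{u_1\}$. The edges $uv$ and $uu_1$ are negative and all other edges are positive. $\dot G_2(c,d)$, $c+d=n-4$: the vertex set is $\{u,v,w,w_1\}\cup C\cup D$ (disjoint), $|C|=c$, $|D|=d$. All pairs of vertices are adjacent except that $w$ is not adjacent to $w_1$, $u$ is not adjacent to any vertex of $D$, and $v$ is not adjacent to any vertex of $C$. The edge $uv$ is negative and all other edges are positive. $\dot G_3(1,n-5)$, $\dot G_4(1,n-5)$, $\dot G_5(1,n-5)$: same underlying graph as $\dot G_2(1,n-5)$, with $C=\{u_1\}$. The set of negative edges is $\{uv,uu_1\}$ for $\dot G_3(1,n-5)$, $\{uv,uw_1\}$ for $\dot G_4(1,n-5)$, and $\{uv,uw_1,uu_1\}$ for $\dot G_5(1,n-5)$; all other edges are positive. -}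

module Defs where

open import Data.Bool.Base using (Bool; true; false; not; _∧_; _∨_; _xor_; if_then_else_; T)
open import Data.Bool.Properties using (∨-comm; xor-comm)
open import Data.Fin.Base using (Fin; zero; suc)
open import Data.Fin.Properties using (_<?_) renaming (_≟_ to _≟ᶠ_)
open import Data.List.Base using (List; []; _∷_; length; filter; cartesianProduct; allFin)
open import Data.List.Relation.Unary.Unique.Propositional using (Unique)
open import Data.Nat.Base as ℕ using (ℕ; _∸_; _≤_; _≥_)
open import Data.Product.Base using (∃-syntax; _×_; _,_)
open import Data.Sign.Base using (Sign; +; -; opposite) renaming (_*_ to _·_)
open import Data.Sum.Base using (_⊎_; inj₁; inj₂)
open import Data.Sum.Properties using (≡-dec)
open import Function.Bundles using (_↔_; Inverse; mk⇔)
open import Relation.Binary.Definitions using (DecidableEquality)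
open import Relation.Binary.PropositionalEquality.Core using (_≡_; _≢_; refl; sym; cong; cong₂)
open import Relation.Nullary.Decidable using (does; does-⇔; T?; _×-dec_; dec-true)
open import Relation.Nullary.Negation.Core using (¬_)

record Graph (V : Set) : Set where
  field
    adj        : V → V → Bool
    adj-sym    : ∀ x y → adj x y ≡ adj y x
    adj-irrefl : ∀ x → adj x x ≡ false

  Adj : V → V → Set
  Adj x y = T (adj x y)

record SignedGraph (V : Set) : Set where
  field
    graph    : Graph V
  open Graph graph public
  field
    sign     : ∀ {x y} → Adj x y → Sign
    sign-sym : ∀ {x y} (p : Adj x y) (q : Adj y x) → sign p ≡ sign q

open SignedGraph

edges : ∀ {n} → Graph (Fin n) → List (Fin n × Fin n)
edges {n} G =
  filter (λ (i , j) → (i <? j) ×-dec T? (Graph.adj G i j))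
         (cartesianProduct (allFin n) (allFin n))

e : ∀ {n} → SignedGraph (Fin n) → ℕ
e G = length (edges (graph G))

data Walk {V : Set} (G : SignedGraph V) : V → V → Set where
  []  : ∀ {x} → Walk G x x
  _∷_ : ∀ {x y z} → Adj G x y → Walk G y z → Walk G x z

module _ {V : Set} {G : SignedGraph V} where

  -- All vertices except the last, so that a closed walk lists its base
  -- point only once.
  vertices : ∀ {x y} → Walk G x y → List V
  vertices         []      = []
  vertices {x = x} (_ ∷ p) = x ∷ vertices p

  walkSign : ∀ {x y} → Walk G x y → Sign
  walkSign []      = +
  walkSign (a ∷ p) = sign G a · walkSign p

  IsCycle : ∀ {x} → Walk G x x → Set
  IsCycle p = 3 ≤ length (vertices p) × Unique (vertices p)

Balanced : ∀ {V} → SignedGraph V → Set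
Balanced {V} G = ∀ {x : V} (p : Walk G x x) → IsCycle p → walkSign p ≡ +

Unbalanced : ∀ {V} → SignedGraph V → Set
Unbalanced G = ¬ Balanced G

-- H is contained in G, up to isomorphism, as a signed subgraph (not
-- necessarily induced).
record _⊑_ {W V : Set} (H : SignedGraph W) (G : SignedGraph V) : Set where
  field
    to      : W → V
    to-inj  : ∀ {x y} → to x ≡ to y → x ≡ y
    to-adj  : ∀ {x y} → Adj H x y → Adj G (to x) (to y)
    to-sign : ∀ {x y} (a : Adj H x y) → sign G (to-adj a) ≡ sign H a

IsComplete : ∀ {V} → SignedGraph V → Set
IsComplete {V} G = ∀ {x y : V} → x ≢ y → Adj G x y

𝒦₄⁻ : SignedGraph (Fin 4) → Set
𝒦₄⁻ H = IsComplete H × Unbalanced H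

𝒦₄⁻-Free : ∀ {V} → SignedGraph V → Set
𝒦₄⁻-Free G = ∀ (H : SignedGraph (Fin 4)) → 𝒦₄⁻ H → ¬ (H ⊑ G)

record _≅_ {V W : Set} (G : SignedGraph V) (H : SignedGraph W) : Set where
  field
    bijection : V ↔ W
  open Inverse bijection public using (to)
  field
    adj-≡  : ∀ x y → adj G x y ≡ adj H (to x) (to y)
    sign-≡ : ∀ {x y} (a : Adj G x y) (b : Adj H (to x) (to y)) → sign G a ≡ sign H b

switch : ∀ {V} → (V → Bool) → SignedGraph V → SignedGraph V
switch U G = record
  { graph    = graph G
  ; sign     = λ {x} {y} a → flip (U x xor U y) (sign G a)
  ; sign-sym = λ {x} {y} a b → cong₂ flip (xor-comm (U x) (U y)) (sign-sym G a b)
  }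
  where
  flip : Bool → Sign → Sign
  flip c s = if c then opposite s else s

_∼_ : ∀ {V W} → SignedGraph V → SignedGraph W → Set
_∼_ {V} G H = ∃[ U ] (switch {V} U G ≅ H)

-- `complement _≟_ M` joins all pairs of distinct vertices except those
-- {x , y} with M x y or M y x, and `negateOn N G` makes exactly the edges
-- xy of G with N x y or N y x negative.  So in the tables below each pair
-- is listed in one orientation only.

complement : ∀ {V} → DecidableEquality V → (V → V → Bool) → Graph V
complement _≟_ M = record
  { adj        = λ x y → not (does (x ≟ y)) ∧ not (M x y ∨ M y x)
  ; adj-sym    = λ x y → cong₂ (λ b c → not b ∧ not c)
                   (does-⇔ (mk⇔ sym sym) (x ≟ y) (y ≟ x)) (∨-comm (M x y) (M y x))
  ; adj-irrefl = λ x → cong (λ b → not b ∧ not (M x x ∨ M x x)) (dec-true (x ≟ x) refl)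
  }

negateOn : ∀ {V} → (V → V → Bool) → Graph V → SignedGraph V
negateOn N G = record
  { graph    = G
  ; sign     = λ {x} {y} _ → signOf (N x y ∨ N y x)
  ; sign-sym = λ {x} {y} _ _ → cong signOf (∨-comm (N x y) (N y x))
  }
  where
  signOf : Bool → Sign
  signOf b = if b then - else +

Vertex : ℕ → ℕ → ℕ → Set
Vertex k a b = Fin k ⊎ (Fin a ⊎ Fin b)

_≟_ : ∀ {k a b} → DecidableEquality (Vertex k a b)
_≟_ = ≡-dec _≟ᶠ_ (≡-dec _≟ᶠ_ _≟ᶠ_)

pattern u  = inj₁ zero
pattern v  = inj₁ (suc zero)
pattern w  = inj₁ (suc (suc zero))
pattern w₁ = inj₁ (suc (suc (suc zero)))

-- The vertices of A and B for the graphs on Vertex 3 a b, and those of C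
-- and D for the graphs on Vertex 4 c d.
pattern inA i = inj₂ (inj₁ i)
pattern inB i = inj₂ (inj₂ i)
pattern inC i = inj₂ (inj₁ i)
pattern inD i = inj₂ (inj₂ i)
pattern u₁    = inj₂ (inj₁ zero)

Γ₁ : ∀ a b → Graph (Vertex 3 a b)
Γ₁ a b = complement _≟_ nonEdge
  where
  nonEdge : Vertex 3 a b → Vertex 3 a b → Bool
  nonEdge u (inB _) = true
  nonEdge v (inA _) = true
  nonEdge _ _       = false

Γ₂ : ∀ c d → Graph (Vertex 4 c d)
Γ₂ c d = complement _≟_ nonEdge
  where
  nonEdge : Vertex 4 c d → Vertex 4 c d → Bool
  nonEdge w w₁      = true
  nonEdge u (inD _) = true
  nonEdge v (inC _) = true
  nonEdge _ _       = false

Ġ₁ : ∀ a b → SignedGraph (Vertex 3 a b)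
Ġ₁ a b = negateOn negative (Γ₁ a b)
  where
  negative : Vertex 3 a b → Vertex 3 a b → Bool
  negative u v = true
  negative _ _ = false

Ġ₁′ : ∀ b → SignedGraph (Vertex 3 1 b)
Ġ₁′ b = negateOn negative (Γ₁ 1 b)
  where
  negative : Vertex 3 1 b → Vertex 3 1 b → Bool
  negative u v  = true
  negative u u₁ = true
  negative _ _  = false

Ġ₂ : ∀ c d → SignedGraph (Vertex 4 c d)
Ġ₂ c d = negateOn negative (Γ₂ c d)
  where
  negative : Vertex 4 c d → Vertex 4 c d → Bool
  negative u v = true
  negative _ _ = false

Ġ₃ : ∀ d → SignedGraph (Vertex 4 1 d)
Ġ₃ d = negateOn negative (Γ₂ 1 d)
  where
  negative : Vertex 4 1 d → Vertex 4 1 d → Bool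
  negative u v  = true
  negative u u₁ = true
  negative _ _  = false

Ġ₄ : ∀ d → SignedGraph (Vertex 4 1 d)
Ġ₄ d = negateOn negative (Γ₂ 1 d)
  where
  negative : Vertex 4 1 d → Vertex 4 1 d → Bool
  negative u v  = true
  negative u w₁ = true
  negative _ _  = false

Ġ₅ : ∀ d → SignedGraph (Vertex 4 1 d)
Ġ₅ d = negateOn negative (Γ₂ 1 d)
  where
  negative : Vertex 4 1 d → Vertex 4 1 d → Bool
  negative u v  = true
  negative u w₁ = true
  negative u u₁ = true
  negative _ _  = false

-- 𝒢 n H : H is a member of the family at order n.  It is used only for
-- n ≥ 7, where the truncated subtractions are exact.
data 𝒢 (n : ℕ) : ∀ {W} → SignedGraph W → Set where
  g₁  : ∀ a b → a ℕ.+ b ≡ n ∸ 3 → 𝒢 n (Ġ₁ a b)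
  g₁′ : 𝒢 n (Ġ₁′ (n ∸ 4))
  g₂  : ∀ c d → c ℕ.+ d ≡ n ∸ 4 → c ≥ 1 → d ≥ 1 → 𝒢 n (Ġ₂ c d)
  g₃  : 𝒢 n (Ġ₃ (n ∸ 5))
  g₄  : 𝒢 n (Ġ₄ (n ∸ 5))
  g₅  : 𝒢 n (Ġ₅ (n ∸ 5))

{-# OPTIONS --safe #-}
module Submission where

-- Let m be the number of non-adjacent pairs; the claim is m ≥ n − 3.
--
-- If there is no negative triangle and m ≤ n − 3, then every walk x₀x₁x₂x₃
-- has the sign of a walk of length at most two with the same ends: use a
-- chord, or else a common neighbour of the four vertices, which exists
-- because x₀x₂, x₁x₃ and one missing pair for each other vertex would make
-- m ≥ n − 2.  So all closed walks are positive.  If ûv̂ŵ is a negative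
-- triangle, then every other vertex misses at least one of û, v̂, ŵ, as
-- there is no unbalanced K₄; hence m ≥ n − 3.
--
-- In the case of equality every other vertex misses exactly one of û, v̂, ŵ,
-- and these vertices form a clique, split into the non-neighbours A of v̂,
-- B of û and D of ŵ.  Order the triangle so that |D| ≤ |A| ≤ |B|.  Triangles
-- lying in a K₄ are positive, which determines the switched signs: |D| ≥ 2
-- would make ûv̂ŵ positive, |D| = 0 gives Γ₁, |D| = 1 gives Γ₂, and signs at
-- û are free only when |A| = 1.

open import Defs
open import Data.Bool.Base using (Bool; true; false; T; not; _∧_; _∨_; _xor_; if_then_else_)
open import Data.Bool.Properties using (T?; T-≡; ∨-comm)
open import Data.Empty using (⊥-elim)
open import Data.Fin.Base using (Fin; zero; suc; _<_)
open import Data.Fin.Patterns using (0F; 1F; 2F; 3F)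
open import Data.Fin.Permutation using (↔⇒≡)
open import Data.Fin.Properties as Fin using (any?; +↔⊎; _<?_; <-cmp; injective⇒≤)
open import Data.List.Base using (List; []; _∷_; _++_; length; lookup; map; filter; cartesianProduct; allFin)
import Data.List.Membership.DecPropositional as Membership
open import Data.List.Membership.Propositional using (_∈_; _∉_; find)
open import Data.List.Membership.Propositional.Properties
open import Data.List.Properties using (length-++; length-map; length-tabulate)
open import Data.List.Relation.Binary.Disjoint.Propositional using (Disjoint)
open import Data.List.Relation.Unary.All as All using (All; []; _∷_)
open import Data.List.Relation.Unary.All.Properties using (¬Any⇒All¬)
open import Data.List.Relation.Unary.AllPairs as AllPairs using (AllPairs; []; _∷_)
import Data.List.Relation.Unary.AllPairs.Properties as AllPairs
open import Data.List.Relation.Unary.Any as Any using (here; there; index)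
open import Data.List.Relation.Unary.Any.Properties using (lookup-index; ¬Any[])
open import Data.List.Relation.Unary.Unique.Propositional using (Unique)
import Data.List.Relation.Unary.Unique.Propositional.Properties as Unique
open import Data.Nat.Base as ℕ using (ℕ; zero; suc; z≤n; s≤s; _+_; _*_; _∸_; _≤_; _≥_)
open import Data.Nat.DivMod using (_/_; m*n/n≡m)
open import Data.Nat.Properties hiding (_<?_; <-cmp; _≟_)
open import Data.Nat.Tactic.RingSolver using (solve-∀)
open import Data.Product.Base using (_×_; _,_; proj₁; proj₂; ∃-syntax; Σ-syntax; swap)
open import Data.Sign.Base using (Sign; opposite) renaming (+ to ⊕; - to ⊖; _*_ to _·_)
open import Data.Sign.Properties as Sign using (s≢opposite[s])
  renaming (*-assoc to ·-assoc; *-comm to ·-comm; s*s≡+ to s·s≡⊕; *-identityʳ to ·-identityʳ)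
open import Data.Sum.Base using (_⊎_; inj₁; inj₂)
open import Data.Sum.Function.Propositional using (_⊎-↔_)
open import Function.Base using (_∘_)
open import Function.Bundles using (Equivalence; Inverse; _⇔_; _↔_; mk⇔; mk↔ₛ′)
open import Function.Properties.Inverse using (↔-refl; ↔-sym; ↔-trans)
open import Level using (0ℓ)
open import Relation.Binary.Definitions using (tri<; tri≈; tri>)
open import Relation.Binary.PropositionalEquality
open import Relation.Nullary.Decidable using (Dec; yes; no; does; map′; decidable-stable; dec-false; _×-dec_; ¬?)
open import Relation.Nullary.Negation using (¬_; contradiction)
open import Relation.Unary using (Pred; Decidable)

open SignedGraph
open module FinMembership {n} = Membership (Fin._≟_ {n}) using (_∈?_)

-- Counting with duplicate-free lists and ordered pairs

lookup-injective : ∀ {A : Set} {xs : List A} → Unique xs → ∀ {i j} → lookup xs i ≡ lookup xs j → i ≡ j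
lookup-injective (_ ∷ _)    {zero}  {zero}  _  = refl
lookup-injective (x∉ ∷ _)   {zero}  {suc j} eq = contradiction eq (All.lookup x∉ (∈-lookup j))
lookup-injective (x∉ ∷ _)   {suc i} {zero}  eq = contradiction (sym eq) (All.lookup x∉ (∈-lookup i))
lookup-injective (_ ∷ uniq) {suc i} {suc j} eq = cong suc (lookup-injective uniq eq)

-- Pigeonhole: sending a position of `xs` to the position of its entry in `ys` is injective, because
-- `xs` has no repetitions.
unique-⊆⇒length≤ : ∀ {A : Set} {xs ys : List A} → Unique xs → (∀ {x} → x ∈ xs → x ∈ ys) → length xs ≤ length ys
unique-⊆⇒length≤ {xs = xs} {ys} uniq sub = injective⇒≤ λ {i} {j} eq →
  lookup-injective uniq (begin
    lookup xs i                                    ≡⟨ lookup-index (sub (∈-lookup i)) ⟩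
    lookup ys (index (sub (∈-lookup {xs = xs} i))) ≡⟨ cong (lookup ys) eq ⟩
    lookup ys (index (sub (∈-lookup {xs = xs} j))) ≡⟨ lookup-index (sub (∈-lookup j)) ⟨
    lookup xs j                                    ∎)
  where open ≡-Reasoning

allPairs : ∀ n → List (Fin n × Fin n)
allPairs n = cartesianProduct (allFin n) (allFin n)

∈-allPairs : ∀ {n} {i j : Fin n} → (i , j) ∈ allPairs n
∈-allPairs = ∈-cartesianProduct⁺ (∈-allFin _) (∈-allFin _)

allPairs-unique : ∀ n → Unique (allPairs n)
allPairs-unique n = Unique.cartesianProduct⁺ (Unique.allFin⁺ n) (Unique.allFin⁺ n)

length-filter-split : ∀ {A : Set} {P Q : Pred A 0ℓ} (P? : Decidable P) (Q? : Decidable Q) xs →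
  length (filter (λ x → P? x ×-dec Q? x) xs) + length (filter (λ x → P? x ×-dec ¬? (Q? x)) xs)
  ≡ length (filter P? xs)
length-filter-split P? Q? []       = refl
length-filter-split P? Q? (x ∷ xs) with P? x | Q? x
... | no _  | _     = length-filter-split P? Q? xs
... | yes _ | yes _ = cong suc (length-filter-split P? Q? xs)
... | yes _ | no _  = trans (+-suc _ _) (cong suc (length-filter-split P? Q? xs))

-- A recursive enumeration of the pairs `i < j`, whose length can be found by induction; the edge
-- count filters the full square instead.
pairs : ∀ n → List (Fin n × Fin n)
pairs zero    = []
pairs (suc n) = map (λ j → zero , suc j) (allFin n) ++ map (λ (i , j) → suc i , suc j) (pairs n)

∈-pairs⁺ : ∀ {n} {i j : Fin n} → i < j → (i , j) ∈ pairs n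
∈-pairs⁺ {suc n} {zero}  {suc j} _         = ∈-++⁺ˡ (∈-map⁺ _ (∈-allFin j))
∈-pairs⁺ {suc n} {suc i} {suc j} (s≤s i<j) = ∈-++⁺ʳ (map _ (allFin n)) (∈-map⁺ _ (∈-pairs⁺ i<j))

∈-pairs⁻ : ∀ {n} {i j : Fin n} → (i , j) ∈ pairs n → i < j
∈-pairs⁻ {suc n} p with ∈-++⁻ (map _ (allFin n)) p
... | inj₁ q with _ , _ , refl ← ∈-map⁻ _ q = s≤s z≤n
... | inj₂ q with _ , r , refl ← ∈-map⁻ _ q = s≤s (∈-pairs⁻ r)

pairs-unique : ∀ n → Unique (pairs n)
pairs-unique zero    = []
pairs-unique (suc n) = Unique.++⁺
  (Unique.map⁺ (λ { refl → refl }) (Unique.allFin⁺ n))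
  (Unique.map⁺ (λ { refl → refl }) (pairs-unique n))
  disjoint
  where
  disjoint : Disjoint (map (λ j → zero , suc j) (allFin n)) (map (λ (i , j) → suc i , suc j) (pairs n))
  disjoint (p , q) with ∈-map⁻ _ p | ∈-map⁻ _ q
  ... | _ , _ , refl | _ , _ , ()

length-allFin : ∀ n → length (allFin n) ≡ n
length-allFin n = length-tabulate {n = n} (λ i → i)

-- Doubling and adding `n` keeps division and truncated subtraction out of the induction.
2*length-pairs : ∀ n → length (pairs n) * 2 + n ≡ n * n
2*length-pairs zero    = refl
2*length-pairs (suc n) = begin
  length (pairs (suc n)) * 2 + suc n          ≡⟨ cong (λ l → l * 2 + suc n) len ⟩
  (n + length (pairs n)) * 2 + suc n          ≡⟨ rearrange n (length (pairs n)) ⟩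
  suc (n + n + (length (pairs n) * 2 + n))    ≡⟨ cong (λ l → suc (n + n + l)) (2*length-pairs n) ⟩
  suc (n + n + n * n)                         ≡⟨ square n ⟩
  suc n * suc n                               ∎
  where
  open ≡-Reasoning
  len : length (pairs (suc n)) ≡ n + length (pairs n)
  len = trans (length-++ (map _ (allFin n)))
    (cong₂ _+_ (trans (length-map _ (allFin n)) (length-allFin n)) (length-map _ (pairs n)))
  rearrange : ∀ n l → (n + l) * 2 + suc n ≡ suc (n + n + (l * 2 + n))
  rearrange = solve-∀
  square : ∀ n → suc (n + n + n * n) ≡ suc n * suc n
  square = solve-∀

length-pairs : ∀ n → length (pairs n) ≡ n * (n ∸ 1) / 2
length-pairs n = begin
  length (pairs n)              ≡⟨ m*n/n≡m (length (pairs n)) 2 ⟨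
  length (pairs n) * 2 / 2      ≡⟨ cong (_/ 2) (begin
    length (pairs n) * 2          ≡⟨ m+n∸n≡m _ n ⟨
    length (pairs n) * 2 + n ∸ n  ≡⟨ cong₂ _∸_ (2*length-pairs n) (sym (*-identityʳ n)) ⟩
    n * n ∸ n * 1                 ≡⟨ *-distribˡ-∸ n n 1 ⟨
    n * (n ∸ 1)                   ∎) ⟩
  n * (n ∸ 1) / 2               ∎
  where open ≡-Reasoning

-- Both lists are duplicate-free and have the same members, so their lengths bound each other.
length-filter-< : ∀ n →
  length (filter (λ (i , j) → i <? j) (allPairs n)) ≡ n * (n ∸ 1) / 2
length-filter-< n = trans (≤-antisym
  (unique-⊆⇒length≤ (Unique.filter⁺ _ (allPairs-unique n))
    λ p → ∈-pairs⁺ (proj₂ (∈-filter⁻ (λ (i , j) → i <? j) {xs = allPairs n} p)))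
  (unique-⊆⇒length≤ (pairs-unique n)
    λ {(i , j)} p → ∈-filter⁺ _ ∈-allPairs (∈-pairs⁻ p)))
  (length-pairs n)

-- Missing pairs

T⇒≡true : ∀ {b} → T b → b ≡ true
T⇒≡true = Equivalence.to T-≡

¬T⇒≡false : ∀ {b} → ¬ T b → b ≡ false
¬T⇒≡false {false} _  = refl
¬T⇒≡false {true}  ¬t = contradiction _ ¬t

Missing : ∀ {V} → SignedGraph V → V → V → Set
Missing G x y = x ≢ y × ¬ Adj G x y

Adj-sym : ∀ {V} (G : SignedGraph V) {x y} → Adj G x y → Adj G y x
Adj-sym G {x} {y} = subst T (adj-sym G x y)

missing-sym : ∀ {V} (G : SignedGraph V) {x y} → Missing G x y → Missing G y x
missing-sym G (x≢y , x≁y) = (x≢y ∘ sym) , (x≁y ∘ Adj-sym G)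

missing? : ∀ {n} (G : SignedGraph (Fin n)) x y → Dec (Missing G x y)
missing? G x y = ¬? (x Fin.≟ y) ×-dec ¬? (T? (adj G x y))

adjacent : ∀ {V} (G : SignedGraph V) {x y} → x ≢ y → ¬ Missing G x y → Adj G x y
adjacent G {x} {y} x≢y ¬m = decidable-stable (T? (adj G x y)) (λ x≁y → ¬m (x≢y , x≁y))

adj⇒≢ : ∀ {V} (G : SignedGraph V) {x y} → Adj G x y → x ≢ y
adj⇒≢ G {x} a refl = subst T (adj-irrefl G x) a

-- Distinctness of unordered pairs, each given in an arbitrary orientation.
Apart : ∀ {V : Set} → V × V → V × V → Set
Apart p q = p ≢ q × p ≢ swap q

module _ {n} (G : SignedGraph (Fin n)) where

  nonEdge? : Decidable (λ ((i , j) : Fin n × Fin n) → i < j × ¬ Adj G i j)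
  nonEdge? (i , j) = (i <? j) ×-dec ¬? (T? (adj G i j))

  nonEdges : List (Fin n × Fin n)
  nonEdges = filter nonEdge? (allPairs n)

  e+nonEdges : e G + length nonEdges ≡ n * (n ∸ 1) / 2
  e+nonEdges = trans
    (length-filter-split (λ (i , j) → i <? j) (λ (i , j) → T? (adj G i j)) (allPairs n))
    (length-filter-< n)

  ∈-nonEdges⁺ : ∀ {i j} → i < j → ¬ Adj G i j → (i , j) ∈ nonEdges
  ∈-nonEdges⁺ i<j i≁j = ∈-filter⁺ nonEdge? ∈-allPairs (i<j , i≁j)

  ∈-nonEdges⁻ : ∀ {i j} → (i , j) ∈ nonEdges → i < j × ¬ Adj G i j
  ∈-nonEdges⁻ = proj₂ ∘ ∈-filter⁻ nonEdge? {xs = allPairs n}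

  nonEdges-unique : Unique nonEdges
  nonEdges-unique = Unique.filter⁺ _ (allPairs-unique n)

  sort : Fin n × Fin n → Fin n × Fin n
  sort (i , j) with i <? j
  ... | yes _ = i , j
  ... | no  _ = j , i

  sort-swap : ∀ p → sort p ≡ p ⊎ sort p ≡ swap p
  sort-swap (i , j) with i <? j
  ... | yes _ = inj₁ refl
  ... | no  _ = inj₂ refl

  sort-apart : ∀ {p q} → Apart p q → sort p ≢ sort q
  sort-apart {p} {q} (p≢q , p≢q′) eq with sort-swap p | sort-swap q
  ... | inj₁ a | inj₁ b = p≢q (trans (sym a) (trans eq b))
  ... | inj₁ a | inj₂ b = p≢q′ (trans (sym a) (trans eq b))
  ... | inj₂ a | inj₁ b = p≢q′ (cong swap (trans (sym a) (trans eq b)))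
  ... | inj₂ a | inj₂ b = p≢q (cong swap (trans (sym a) (trans eq b)))

  sort-missing : ∀ {i j} → Missing G i j → sort (i , j) ∈ nonEdges
  sort-missing {i} {j} (i≢j , i≁j) with i <? j
  ... | yes i<j = ∈-nonEdges⁺ i<j i≁j
  ... | no  i≮j with <-cmp i j
  ...   | tri< i<j _ _ = contradiction i<j i≮j
  ...   | tri≈ _ i≡j _ = contradiction i≡j i≢j
  ...   | tri> _ _ j<i = ∈-nonEdges⁺ j<i (i≁j ∘ Adj-sym G)

  -- Sorting sends pairs that differ as unordered pairs to different members of `nonEdges`.
  apart⇒length≤ : ∀ {E} → All (λ (i , j) → Missing G i j) E → AllPairs Apart E → length E ≤ length nonEdges
  apart⇒length≤ {E} missing apart = subst (_≤ length nonEdges) (length-map sort E)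
    (unique-⊆⇒length≤ (AllPairs.map⁺ (AllPairs.map sort-apart apart))
      λ p → case (∈-map⁻ sort p))
    where
    case : ∀ {p} → ∃[ q ] (q ∈ E × p ≡ sort q) → p ∈ nonEdges
    case (_ , q , refl) = sort-missing (All.lookup missing q)

  -- Each vertex of ys spends a missing pair joining it to core; none of
  -- them is among the pairs E.
  star-bound : ∀ (core : List (Fin n)) {ys E} → Unique ys →
    All (λ y → y ∉ core × ∃[ c ] (c ∈ core × Missing G y c)) ys →
    All (λ (i , j) → Missing G i j) E → AllPairs Apart E →
    All (λ (i , j) → ¬ (i ∈ ys × j ∈ core) × ¬ (j ∈ ys × i ∈ core)) E →
    length ys + length E ≤ length nonEdges
  star-bound core [] [] missing apart _ = apart⇒length≤ missing apart
  star-bound core {y ∷ ys} {E} (y∉ys ∷ uniq) ((y∉core , c , c∈core , y≁c) ∷ ok) missing apart away =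
    -- The pair of the head vertex moves into `E`. The remaining vertices cannot spend it again: `y`
    -- is not among them, and neither is `c`, since they all avoid `core`.
    subst (_≤ length nonEdges) (+-suc (length ys) (length E))
      (star-bound core uniq ok (y≁c ∷ missing) (All.map new away ∷ apart)
        ( ((λ (y∈ys , _) → All.lookup y∉ys y∈ys refl) , (λ (c∈ys , _) → proj₁ (All.lookup ok c∈ys) c∈core))
        ∷ All.map (λ (f , g) → (λ (i , j) → f (there i , j)) , (λ (j , i) → g (there j , i))) away))
    where
    new : ∀ {p} → ¬ (proj₁ p ∈ y ∷ ys × proj₂ p ∈ core) × ¬ (proj₂ p ∈ y ∷ ys × proj₁ p ∈ core) →
          Apart (y , c) p
    new (f , g) = (λ { refl → f (here refl , c∈core) }) , (λ { refl → g (here refl , c∈core) })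

  outside : List (Fin n) → List (Fin n)
  outside xs = filter (λ x → ¬? (x ∈? xs)) (allFin n)

  ∈-outside⁺ : ∀ {x xs} → x ∉ xs → x ∈ outside xs
  ∈-outside⁺ = ∈-filter⁺ _ (∈-allFin _)

  ∈-outside⁻ : ∀ {x} xs → x ∈ outside xs → x ∉ xs
  ∈-outside⁻ xs p = proj₂ (∈-filter⁻ (λ x → ¬? (x ∈? xs)) {xs = allFin n} p)

  outside-unique : ∀ xs → Unique (outside xs)
  outside-unique xs = Unique.filter⁺ _ (Unique.allFin⁺ n)

  -- Together `xs` and its outside cover all `n` vertices. Only an inequality is claimed, as `xs`
  -- may have repeated entries.
  length-outside : ∀ xs → n ∸ length xs ≤ length (outside xs)
  length-outside xs = subst (n ∸ length xs ≤_) (trans (cong (_∸ length xs) (length-++ xs)) (m+n∸m≡n (length xs) _))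
    (∸-monoˡ-≤ (length xs) (subst (_≤ length (xs ++ outside xs)) (length-allFin n)
      (unique-⊆⇒length≤ (Unique.allFin⁺ n) λ {x} _ → covered x)))
    where
    covered : ∀ x → x ∈ xs ++ outside xs
    covered x with x ∈? xs
    ... | yes x∈xs = ∈-++⁺ˡ x∈xs
    ... | no  x∉xs = ∈-++⁺ʳ xs (∈-outside⁺ x∉xs)

  -- xs lists the core together with the vertices that the pairs E already
  -- account for.
  core-bound : ∀ core xs {E} → (∀ {c} → c ∈ core → c ∈ xs) →
    (∀ {y} → y ∉ xs → ∃[ c ] (c ∈ core × Missing G y c)) →
    All (λ (i , j) → Missing G i j) E → AllPairs Apart E →
    All (λ (i , j) → (i ∈ xs ⊎ j ∉ core) × (j ∈ xs ⊎ i ∉ core)) E →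
    n ∸ length xs + length E ≤ length nonEdges
  core-bound core xs {E} core⊆xs hit missing apart away =
    ≤-trans (+-monoˡ-≤ (length E) (length-outside xs))
      (star-bound core (outside-unique xs)
        (All.tabulate λ y → (∈-outside⁻ xs y ∘ core⊆xs) , hit (∈-outside⁻ xs y))
        missing apart (All.map (λ (f , g) → excl f , excl g) away))
    where
    excl : ∀ {i j} → i ∈ xs ⊎ j ∉ core → ¬ (i ∈ outside xs × j ∈ core)
    excl (inj₁ i∈xs) (p , _) = ∈-outside⁻ xs p i∈xs
    excl (inj₂ j∉)   (_ , q) = j∉ q

-- Signs and triangles

·-cancel : ∀ a b → a · (a · b) ≡ b
·-cancel a b = trans (sym (·-assoc a a b)) (cong (_· b) (s·s≡⊕ a))

⊕-last : ∀ a b {c} → a · b · c ≡ ⊕ → c ≡ a · b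
⊕-last a b {c} eq = begin
  c                     ≡⟨ ·-cancel (a · b) c ⟨
  a · b · (a · b · c)   ≡⟨ cong (a · b ·_) eq ⟩
  a · b · ⊕             ≡⟨ ·-identityʳ (a · b) ⟩
  a · b                 ∎
  where open ≡-Reasoning

-- The left side is `n ∸ 2`; `4 ≤ n` keeps the truncated subtractions exact.
exceeds : ∀ {n} → 4 ≤ n → ¬ (n ∸ 4 + 2 ≤ n ∸ 3)
exceeds {suc (suc (suc (suc k)))} _ le = 1+n≰n (subst (_≤ suc k) (+-comm k 2) le)

-- Signs extended by ⊕ to non-adjacent pairs.
σ : ∀ {V} → SignedGraph V → V → V → Sign
σ G x y with T? (adj G x y)
... | yes a = sign G a
... | no  _ = ⊕

sign≡σ : ∀ {V} (G : SignedGraph V) {x y} (a : Adj G x y) → sign G a ≡ σ G x y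
sign≡σ G {x} {y} a with T? (adj G x y)
... | yes b = trans (sign-sym G a (Adj-sym G a)) (sym (sign-sym G b (Adj-sym G a)))
... | no ¬a = contradiction a ¬a

σ-sym : ∀ {V} (G : SignedGraph V) x y → σ G x y ≡ σ G y x
σ-sym G x y with T? (adj G x y) | T? (adj G y x)
... | yes a | yes b = sign-sym G a b
... | yes a | no ¬b = contradiction (Adj-sym G a) ¬b
... | no ¬a | yes b = contradiction (Adj-sym G b) ¬a
... | no _  | no _  = refl

tri : ∀ {V} → SignedGraph V → V → V → V → Sign
tri G x y z = σ G x y · σ G y z · σ G x z

record NegativeTriangle {V} (G : SignedGraph V) (x y z : V) : Set where
  constructor negativeTriangle
  field
    xy   : Adj G x y
    yz   : Adj G y z
    xz   : Adj G x z
    tri⊖ : tri G x y z ≡ ⊖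

swap₁₂ : ∀ {V} {G : SignedGraph V} {x y z} → NegativeTriangle G x y z → NegativeTriangle G y x z
swap₁₂ {G = G} {x} {y} {z} (negativeTriangle xy yz xz neg) = negativeTriangle (Adj-sym G xy) xz yz (begin
  σ G y x · σ G x z · σ G y z    ≡⟨ ·-assoc (σ G y x) _ _ ⟩
  σ G y x · (σ G x z · σ G y z)  ≡⟨ cong₂ _·_ (σ-sym G y x) (·-comm (σ G x z) _) ⟩
  σ G x y · (σ G y z · σ G x z)  ≡⟨ ·-assoc (σ G x y) _ _ ⟨
  tri G x y z                    ≡⟨ neg ⟩
  ⊖                              ∎)
  where open ≡-Reasoning

swap₂₃ : ∀ {V} {G : SignedGraph V} {x y z} → NegativeTriangle G x y z → NegativeTriangle G x z y
swap₂₃ {G = G} {x} {y} {z} (negativeTriangle xy yz xz neg) = negativeTriangle xz (Adj-sym G yz) xy (begin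
  σ G x z · σ G z y · σ G x y    ≡⟨ ·-comm (σ G x z · σ G z y) _ ⟩
  σ G x y · (σ G x z · σ G z y)  ≡⟨ cong (σ G x y ·_)
                                      (trans (·-comm (σ G x z) _) (cong (_· σ G x z) (σ-sym G z y))) ⟩
  σ G x y · (σ G y z · σ G x z)  ≡⟨ ·-assoc (σ G x y) _ _ ⟨
  tri G x y z                    ≡⟨ neg ⟩
  ⊖                              ∎)
  where open ≡-Reasoning

module _ {V : Set} (G : SignedGraph V) where

  pullback : ∀ {W} → (W → V) → SignedGraph W
  pullback f = record
    { graph    = record
      { adj        = λ x y → adj G (f x) (f y)
      ; adj-sym    = λ x y → adj-sym G (f x) (f y)
      ; adj-irrefl = λ x → adj-irrefl G (f x)
      }
    ; sign     = sign G
    ; sign-sym = sign-sym G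
    }

  -- Injectivity comes from completeness: distinct indices have adjacent images, and adjacent
  -- vertices differ.
  complete⇒pullback-⊑ : (f : Fin 4 → V) → IsComplete (pullback f) → pullback f ⊑ G
  complete⇒pullback-⊑ f complete = record
    { to      = f
    ; to-inj  = to-inj _ _
    ; to-adj  = λ a → a
    ; to-sign = λ _ → refl
    }
    where
    to-inj : ∀ x y → f x ≡ f y → x ≡ y
    to-inj x y eq with x Fin.≟ y
    ... | yes x≡y = x≡y
    ... | no  x≢y = contradiction eq (adj⇒≢ G (complete x≢y))

  module _ (free : 𝒦₄⁻-Free G) where

    -- The four vertices span a `K₄` in which `xyz` would be a negative cycle, so the `K₄` would be
    -- a forbidden subgraph.
    K₄⇒tri≢⊖ : ∀ {x y z t} → Adj G x y → Adj G y z → Adj G x z →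
      Adj G t x → Adj G t y → Adj G t z → tri G x y z ≢ ⊖
    K₄⇒tri≢⊖ {x} {y} {z} {t} xy yz xz tx ty tz neg =
      free (pullback f) (complete , unbalanced) (complete⇒pullback-⊑ f complete)
      where
      f : Fin 4 → V
      f 0F = x
      f 1F = y
      f 2F = z
      f 3F = t
      joined : ∀ p q → p ≢ q → Adj G (f p) (f q)
      joined 0F 0F p≢p = contradiction refl p≢p
      joined 0F 1F _   = xy
      joined 0F 2F _   = xz
      joined 0F 3F _   = Adj-sym G tx
      joined 1F 0F _   = Adj-sym G xy
      joined 1F 1F p≢p = contradiction refl p≢p
      joined 1F 2F _   = yz
      joined 1F 3F _   = Adj-sym G ty
      joined 2F 0F _   = Adj-sym G xz
      joined 2F 1F _   = Adj-sym G yz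
      joined 2F 2F p≢p = contradiction refl p≢p
      joined 2F 3F _   = Adj-sym G tz
      joined 3F 0F _   = tx
      joined 3F 1F _   = ty
      joined 3F 2F _   = tz
      joined 3F 3F p≢p = contradiction refl p≢p
      complete : IsComplete (pullback f)
      complete = joined _ _
      triangle : Walk (pullback f) 0F 0F
      triangle = _∷_ {y = 1F} xy (_∷_ {y = 2F} yz (_∷_ {y = 0F} (Adj-sym G xz) []))
      triangle-sign : walkSign triangle ≡ ⊖
      triangle-sign = begin
        sign G xy · (sign G yz · (sign G (Adj-sym G xz) · ⊕))
          ≡⟨ cong₂ _·_ (sign≡σ G xy) (cong₂ _·_ (sign≡σ G yz)
               (trans (·-identityʳ _) (trans (sym (sign-sym G xz (Adj-sym G xz))) (sign≡σ G xz)))) ⟩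
        σ G x y · (σ G y z · σ G x z) ≡⟨ ·-assoc (σ G x y) _ _ ⟨
        tri G x y z                   ≡⟨ neg ⟩
        ⊖                             ∎
        where open ≡-Reasoning
      unbalanced : Unbalanced (pullback f)
      unbalanced balanced with trans (sym (balanced triangle
        (s≤s (s≤s (s≤s z≤n)) , ((λ ()) ∷ (λ ()) ∷ []) ∷ ((λ ()) ∷ []) ∷ [] ∷ []))) triangle-sign
      ... | ()

    K₄⇒tri≡⊕ : ∀ {x y z t} → Adj G x y → Adj G y z → Adj G x z →
      Adj G t x → Adj G t y → Adj G t z → tri G x y z ≡ ⊕
    K₄⇒tri≡⊕ {x} {y} {z} xy yz xz tx ty tz with tri G x y z in eq
    ... | ⊕ = refl
    ... | ⊖ = contradiction eq (K₄⇒tri≢⊖ xy yz xz tx ty tz)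

negativeTriangle? : ∀ {n} (G : SignedGraph (Fin n)) x y z → Dec (NegativeTriangle G x y z)
negativeTriangle? G x y z = map′
  (λ (xy , yz , xz , neg) → negativeTriangle xy yz xz neg)
  (λ (negativeTriangle xy yz xz neg) → xy , yz , xz , neg)
  (T? (adj G x y) ×-dec T? (adj G y z) ×-dec T? (adj G x z) ×-dec (tri G x y z Sign.≟ ⊖))

-- Balance without negative triangles

-- The signs of walks of length at most two, written with `σ` so that they do not depend on
-- adjacency proofs.
data Short {V} (G : SignedGraph V) : V → V → Sign → Set where
  stay : ∀ {x} → Short G x x ⊕
  hop  : ∀ {x y} → Adj G x y → Short G x y (σ G x y)
  hop₂ : ∀ {x y z} → Adj G x y → Adj G y z → Short G x z (σ G x y · σ G y z)

short-closed : ∀ {V} (G : SignedGraph V) {x s} → Short G x x s → s ≡ ⊕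
short-closed G stay                     = refl
short-closed G (hop a)                  = contradiction refl (adj⇒≢ G a)
short-closed G {x} (hop₂ {y = y} _ _)   = trans (cong (σ G x y ·_) (σ-sym G y x)) (s·s≡⊕ (σ G x y))

module _ {n} (n≥4 : 4 ≤ n) (G : SignedGraph (Fin n)) (few : length (nonEdges G) ≤ n ∸ 3)
  (noNeg : ∀ x y z → ¬ NegativeTriangle G x y z) where

  triangle-σ : ∀ {x y z} → Adj G x y → Adj G y z → Adj G x z → σ G x z ≡ σ G x y · σ G y z
  triangle-σ {x} {y} {z} xy yz xz with tri G x y z in eq
  ... | ⊕ = ⊕-last (σ G x y) (σ G y z) eq
  ... | ⊖ = contradiction (negativeTriangle xy yz xz eq) (noNeg x y z)

  -- Otherwise each vertex outside the four misses one of them; with the two given pairs this makes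
  -- `n ∸ 4 + 2` missing pairs, against `few`.
  common-neighbour : ∀ {x₀ x₁ x₂ x₃} → Adj G x₀ x₁ → Adj G x₁ x₂ → Adj G x₂ x₃ →
    Missing G x₀ x₂ → Missing G x₁ x₃ →
    ∃[ y ] (Adj G y x₀ × Adj G y x₁ × Adj G y x₂ × Adj G y x₃)
  common-neighbour {x₀} {x₁} {x₂} {x₃} a₀₁ a₁₂ a₂₃ m₀₂ m₁₃
    with any? (λ y → T? (adj G y x₀) ×-dec T? (adj G y x₁) ×-dec T? (adj G y x₂) ×-dec T? (adj G y x₃))
  ... | yes found = found
  ... | no none = contradiction (≤-trans (core-bound G core core (λ c → c) hit (m₀₂ ∷ m₁₃ ∷ [])
      -- The two given pairs differ as unordered pairs: `x₀ ≡ x₁` contradicts `a₀₁`, and `x₀ ≡ x₃`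
      -- would make `a₂₃` an edge joining `x₀` and `x₂`.
      ((((adj⇒≢ G a₀₁ ∘ cong proj₁) , (λ { refl → proj₂ m₀₂ (Adj-sym G a₂₃) })) ∷ []) ∷ [] ∷ [])
      ((inj₁ (here refl) , inj₁ (there (there (here refl)))) ∷
       (inj₁ (there (here refl)) , inj₁ (there (there (there (here refl))))) ∷ []))
      few) (exceeds n≥4)
    where
    core : List (Fin n)
    core = x₀ ∷ x₁ ∷ x₂ ∷ x₃ ∷ []
    hit : ∀ {y} → y ∉ core → ∃[ c ] (c ∈ core × Missing G y c)
    hit {y} y∉ with missing? G y x₀ | missing? G y x₁ | missing? G y x₂ | missing? G y x₃
    ... | yes m | _ | _ | _ = x₀ , here refl , m
    ... | _ | yes m | _ | _ = x₁ , there (here refl) , m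
    ... | _ | _ | yes m | _ = x₂ , there (there (here refl)) , m
    ... | _ | _ | _ | yes m = x₃ , there (there (there (here refl))) , m
    ... | no ¬0 | no ¬1 | no ¬2 | no ¬3 = contradiction
      ( y
      , adjacent G (λ { refl → y∉ (here refl) }) ¬0
      , adjacent G (λ { refl → y∉ (there (here refl)) }) ¬1
      , adjacent G (λ { refl → y∉ (there (there (here refl))) }) ¬2
      , adjacent G (λ { refl → y∉ (there (there (there (here refl)))) }) ¬3
      ) none

  -- A walk `x₀x₁x₂x₃` shrinks by cancelling an edge walked back and forth, by a chord closing a
  -- positive triangle, or by the detour `x₀yx₃` through a common neighbour `y`. In the last case
  -- `y` forms a positive triangle with each of the three edges.
  extend : ∀ {x y z s} → Adj G x y → Short G y z s → Short G x z (σ G x y · s)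
  extend {x} {y} a stay = subst (Short G x y) (sym (·-identityʳ _)) (hop a)
  extend a (hop b) = hop₂ a b
  extend {x₀} {x₁} {x₃} a₀₁ (hop₂ {y = x₂} a₁₂ a₂₃)
    with x₀ Fin.≟ x₂ | T? (adj G x₀ x₂) | x₁ Fin.≟ x₃ | T? (adj G x₁ x₃)
  ... | yes refl | _ | _ | _ = subst (Short G x₀ x₃)
        (sym (trans (cong (λ s → σ G x₀ x₁ · (s · σ G x₀ x₃)) (σ-sym G x₁ x₀)) (·-cancel (σ G x₀ x₁) _)))
        (hop a₂₃)
  ... | _ | yes a₀₂ | _ | _ = subst (Short G x₀ x₃)
        (trans (cong (_· σ G x₂ x₃) (triangle-σ a₀₁ a₁₂ a₀₂)) (·-assoc (σ G x₀ x₁) _ _))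
        (hop₂ a₀₂ a₂₃)
  ... | _ | _ | yes refl | _ = subst (Short G x₀ x₁)
        (sym (trans (cong (λ s → σ G x₀ x₁ · (σ G x₁ x₂ · s)) (σ-sym G x₂ x₁))
          (trans (cong (σ G x₀ x₁ ·_) (s·s≡⊕ (σ G x₁ x₂))) (·-identityʳ _))))
        (hop a₀₁)
  ... | _ | _ | _ | yes a₁₃ = subst (Short G x₀ x₃)
        (cong (σ G x₀ x₁ ·_) (triangle-σ a₁₂ a₂₃ a₁₃))
        (hop₂ a₀₁ a₁₃)
  ... | no x₀≢x₂ | no x₀≁x₂ | no x₁≢x₃ | no x₁≁x₃
    with y , y₀ , y₁ , y₂ , y₃ ← common-neighbour a₀₁ a₁₂ a₂₃ (x₀≢x₂ , x₀≁x₂) (x₁≢x₃ , x₁≁x₃) =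
      subst (Short G x₀ x₃) (begin
        σ G x₀ y · σ G y x₃
          ≡⟨ cong₂ _·_ (σ-sym G x₀ y) (triangle-σ y₂ a₂₃ y₃) ⟩
        σ G y x₀ · (σ G y x₂ · σ G x₂ x₃)
          ≡⟨ cong (λ s → σ G y x₀ · (s · σ G x₂ x₃)) (triangle-σ y₁ a₁₂ y₂) ⟩
        σ G y x₀ · (σ G y x₁ · σ G x₁ x₂ · σ G x₂ x₃)
          ≡⟨ cong (λ s → σ G y x₀ · (s · σ G x₁ x₂ · σ G x₂ x₃)) (triangle-σ y₀ a₀₁ y₁) ⟩
        σ G y x₀ · (σ G y x₀ · σ G x₀ x₁ · σ G x₁ x₂ · σ G x₂ x₃)
          ≡⟨ cong (σ G y x₀ ·_) (trans (·-assoc (σ G y x₀ · σ G x₀ x₁) _ _) (·-assoc (σ G y x₀) _ _)) ⟩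
        σ G y x₀ · (σ G y x₀ · (σ G x₀ x₁ · (σ G x₁ x₂ · σ G x₂ x₃)))
          ≡⟨ ·-cancel (σ G y x₀) _ ⟩
        σ G x₀ x₁ · (σ G x₁ x₂ · σ G x₂ x₃)
          ∎)
      (hop₂ (Adj-sym G y₀) y₃)
      where open ≡-Reasoning

  shorten : ∀ {x y} (p : Walk G x y) → Short G x y (walkSign p)
  shorten []      = stay
  shorten (_∷_ {x} {z = z} a p) = subst (Short G x z) (cong (_· walkSign p) (sym (sign≡σ G a))) (extend a (shorten p))

  balanced : Balanced G
  balanced p _ = short-closed G (shorten p)

-- The structure around a negative triangle

module _ {n} (G : SignedGraph (Fin n)) (free : 𝒦₄⁻-Free G) where

  core : Fin n → Fin n → Fin n → List (Fin n)
  core x y z = x ∷ y ∷ z ∷ []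

  module _ {x y z} (triangle : NegativeTriangle G x y z) where
    open NegativeTriangle triangle

    core-adj : ∀ {c c′} → c ∈ core x y z → c′ ∈ core x y z → c ≢ c′ → Adj G c c′
    core-adj (here refl)                 (here refl)                 c≢c = contradiction refl c≢c
    core-adj (here refl)                 (there (here refl))         _   = xy
    core-adj (here refl)                 (there (there (here refl))) _   = xz
    core-adj (there (here refl))         (here refl)                 _   = Adj-sym G xy
    core-adj (there (here refl))         (there (here refl))         c≢c = contradiction refl c≢c
    core-adj (there (here refl))         (there (there (here refl))) _   = yz
    core-adj (there (there (here refl))) (here refl)                 _   = Adj-sym G xz
    core-adj (there (there (here refl))) (there (here refl))         _   = Adj-sym G yz
    core-adj (there (there (here refl))) (there (there (here refl))) c≢c = contradiction refl c≢c

    missing-core : ∀ {t c} → c ∈ core x y z → Missing G t c → t ∉ core x y z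
    missing-core c∈ (t≢c , t≁c) t∈ = t≁c (core-adj t∈ c∈ t≢c)

    -- A vertex adjacent to all three would complete the negative triangle to an unbalanced `K₄`.
    core-hit : ∀ {t} → t ∉ core x y z → ∃[ c ] (c ∈ core x y z × Missing G t c)
    core-hit {t} t∉ with missing? G t x | missing? G t y | missing? G t z
    ... | yes m | _ | _ = x , here refl , m
    ... | _ | yes m | _ = y , there (here refl) , m
    ... | _ | _ | yes m = z , there (there (here refl)) , m
    ... | no ¬x | no ¬y | no ¬z = contradiction tri⊖ (K₄⇒tri≢⊖ G free xy yz xz
      (adjacent G (λ { refl → t∉ (here refl) }) ¬x)
      (adjacent G (λ { refl → t∉ (there (here refl)) }) ¬y)
      (adjacent G (λ { refl → t∉ (there (there (here refl))) }) ¬z))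

    nonEdges≥ : n ∸ 3 ≤ length (nonEdges G)
    nonEdges≥ = subst (_≤ length (nonEdges G)) (+-identityʳ (n ∸ 3))
      (core-bound G (core x y z) (core x y z) (λ c → c) core-hit [] [] [])

  -- The structure left by a tight count: every missing pair joins an outside vertex to the
  -- triangle, and no outside vertex has two of them.
  record Extremal (x y z : Fin n) : Set where
    field
      triangle : NegativeTriangle G x y z
      one      : ∀ {t c c′} → c ∈ core x y z → c′ ∈ core x y z → c ≢ c′ → Missing G t c → ¬ Missing G t c′
      clique   : ∀ {t t′} → t ∉ core x y z → t′ ∉ core x y z → t ≢ t′ → Adj G t t′

  module _ (n≥4 : 4 ≤ n) {x y z} (triangle : NegativeTriangle G x y z) (few : length (nonEdges G) ≤ n ∸ 3) where

    extremal : Extremal x y z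
    extremal = record { triangle = triangle ; one = one ; clique = clique }
      where
      one : ∀ {t c c′} → c ∈ core x y z → c′ ∈ core x y z → c ≢ c′ → Missing G t c → ¬ Missing G t c′
      -- Counting `t` separately, its two missing pairs come on top of one for each of the `n ∸ 4`
      -- vertices that remain.
      one {t} c∈ c′∈ c≢c′ m m′ = exceeds n≥4 (≤-trans
        (core-bound G (core x y z) (t ∷ core x y z) there (λ y∉ → core-hit triangle (y∉ ∘ there))
          (m ∷ m′ ∷ []) ((((c≢c′ ∘ cong proj₂) , (λ { refl → proj₁ m′ refl })) ∷ []) ∷ [] ∷ [])
          ((inj₁ (here refl) , inj₁ (there c∈)) ∷ (inj₁ (here refl) , inj₁ (there c′∈)) ∷ []))
        few)
      clique : ∀ {t t′} → t ∉ core x y z → t′ ∉ core x y z → t ≢ t′ → Adj G t t′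
      -- A missing pair disjoint from the triangle would be one more than the `n ∸ 3` pairs meeting
      -- it.
      clique {t} {t′} t∉ t′∉ t≢t′ = adjacent G t≢t′ λ m → 1+n≰n (≤-trans
        (subst (_≤ length (nonEdges G)) (+-comm (n ∸ 3) 1)
          (core-bound G (core x y z) (core x y z) (λ c → c) (core-hit triangle)
            (m ∷ []) ([] ∷ []) ((inj₂ t′∉ , inj₂ t∉) ∷ [])))
        few)

  -- Apart from the triangle itself, the conditions in `Extremal` depend on the core only as a set.
  reorder : ∀ {x y z x′ y′ z′} → (∀ {t} → t ∈ core x y z → t ∈ core x′ y′ z′) →
    (∀ {t} → t ∈ core x′ y′ z′ → t ∈ core x y z) →
    (NegativeTriangle G x y z → NegativeTriangle G x′ y′ z′) → Extremal x y z → Extremal x′ y′ z′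
  reorder to from f ext = record
    { triangle = f triangle
    ; one      = λ c∈ c′∈ → one (from c∈) (from c′∈)
    ; clique   = λ t∉ t′∉ → clique (t∉ ∘ to) (t′∉ ∘ to)
    } where open Extremal ext

  extremal-swap₁₂ : ∀ {x y z} → Extremal x y z → Extremal y x z
  extremal-swap₁₂ = reorder (exchange _) (exchange _) swap₁₂
    where
    exchange : ∀ zs {t x y} → t ∈ x ∷ y ∷ zs → t ∈ y ∷ x ∷ zs
    exchange _ (here eq)         = there (here eq)
    exchange _ (there (here eq)) = here eq
    exchange _ (there (there p)) = there (there p)

  extremal-swap₂₃ : ∀ {x y z} → Extremal x y z → Extremal x z y
  extremal-swap₂₃ = reorder exchange exchange swap₂₃
    where
    exchange : ∀ {t x y z} → t ∈ core x y z → t ∈ core x z y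
    exchange (here eq)                 = here eq
    exchange (there (here eq))         = there (there (here eq))
    exchange (there (there (here eq))) = there (here eq)

  -- The list is a parameter rather than the computed `nonNeighbours c`, so that `classify` can
  -- match on its shape.
  record NonNeighbours (c : Fin n) (xs : List (Fin n)) : Set where
    field
      unique : Unique xs
      ∈⇒missing : ∀ {x} → x ∈ xs → Missing G x c
      missing⇒∈ : ∀ {x} → Missing G x c → x ∈ xs

  nonNeighbours : Fin n → List (Fin n)
  nonNeighbours c = filter (λ x → missing? G x c) (allFin n)

  nonNeighbours-correct : ∀ c → NonNeighbours c (nonNeighbours c)
  nonNeighbours-correct c = record
    { unique    = Unique.filter⁺ _ (Unique.allFin⁺ n)
    ; ∈⇒missing = proj₂ ∘ ∈-filter⁻ (λ x → missing? G x c) {xs = allFin n}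
    ; missing⇒∈ = ∈-filter⁺ _ (∈-allFin _)
    }

  codegree : Fin n → ℕ
  codegree = length ∘ nonNeighbours

  -- The roles to come: `x` is `û` with the largest class `B`, `y` is `v̂` with `A`, and `z` is `ŵ`
  -- with the smallest class `D`.
  record Sorted : Set where
    field
      {x y z} : Fin n
      extreme : Extremal x y z
      z≤y     : codegree z ≤ codegree y
      y≤x     : codegree y ≤ codegree x

  sorted : ∀ {x y z} → Extremal x y z → Sorted
  sorted {x} {y} {z} ext
    with ≤-total (codegree y) (codegree x) | ≤-total (codegree z) (codegree y) | ≤-total (codegree z) (codegree x)
  ... | inj₁ y≤x | inj₁ z≤y | _        = record { extreme = ext ; z≤y = z≤y ; y≤x = y≤x }
  ... | inj₁ y≤x | inj₂ y≤z | inj₁ z≤x = record { extreme = extremal-swap₂₃ ext ; z≤y = y≤z ; y≤x = z≤x }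
  ... | inj₁ y≤x | inj₂ y≤z | inj₂ x≤z = record
    { extreme = extremal-swap₁₂ (extremal-swap₂₃ ext) ; z≤y = y≤x ; y≤x = x≤z }
  ... | inj₂ x≤y | inj₁ z≤y | inj₁ z≤x = record { extreme = extremal-swap₁₂ ext ; z≤y = z≤x ; y≤x = x≤y }
  ... | inj₂ x≤y | inj₁ z≤y | inj₂ x≤z = record
    { extreme = extremal-swap₂₃ (extremal-swap₁₂ ext) ; z≤y = x≤z ; y≤x = z≤y }
  ... | inj₂ x≤y | inj₂ y≤z | _        = record
    { extreme = extremal-swap₁₂ (extremal-swap₂₃ (extremal-swap₁₂ ext)) ; z≤y = x≤y ; y≤x = y≤z }

∈-singleton⁻ : ∀ {A : Set} {x y : A} → x ∈ y ∷ [] → x ≡ y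
∈-singleton⁻ (here eq) = eq

-- Pigeonhole again; it supplies the extra vertices that complete triangles to a `K₄`.
avoid : ∀ {n} (ys : List (Fin n)) {xs} → Unique xs → length ys ℕ.< length xs → ∃[ x ] (x ∈ xs × x ∉ ys)
avoid ys {xs} uniq ys<xs with Any.any? (λ x → ¬? (x ∈? ys)) xs
... | yes p = find p
... | no ¬p = contradiction (unique-⊆⇒length≤ uniq xs⊆ys) (<⇒≱ ys<xs)
  where
  xs⊆ys : ∀ {x} → x ∈ xs → x ∈ ys
  xs⊆ys {x} x∈ with x ∈? ys
  ... | yes x∈ys = x∈ys
  ... | no  x∉ys = contradiction x∉ys (All.lookup (¬Any⇒All¬ xs ¬p) x∈)

-- Signs in the extremal case

module Signs {n} (G : SignedGraph (Fin n)) (free : 𝒦₄⁻-Free G) {û v̂ ŵ} (extreme : Extremal G free û v̂ ŵ)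
  {A B D} (A-class : NonNeighbours G free v̂ A) (B-class : NonNeighbours G free û B)
  (D-class : NonNeighbours G free ŵ D) where

  open Extremal extreme
  open NegativeTriangle triangle renaming (xy to ûv̂; yz to v̂ŵ; xz to ûŵ)

  K : List (Fin n)
  K = core G free û v̂ ŵ

  û∈K : û ∈ K
  û∈K = here refl
  v̂∈K : v̂ ∈ K
  v̂∈K = there (here refl)
  ŵ∈K : ŵ ∈ K
  ŵ∈K = there (there (here refl))

  v̂~û : Adj G v̂ û
  v̂~û = Adj-sym G ûv̂
  ŵ~û : Adj G ŵ û
  ŵ~û = Adj-sym G ûŵ
  ŵ~v̂ : Adj G ŵ v̂
  ŵ~v̂ = Adj-sym G v̂ŵ

  module Class {c xs} (c∈K : c ∈ K) (class : NonNeighbours G free c xs) where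

    ∉K : ∀ {t} → t ∈ xs → t ∉ K
    ∉K t∈ = missing-core G free triangle c∈K (NonNeighbours.∈⇒missing class t∈)

    ~other : ∀ {t c′} → c′ ∈ K → c ≢ c′ → t ∈ xs → Adj G c′ t
    ~other c′∈K c≢c′ t∈ = Adj-sym G (adjacent G
      (λ { refl → ∉K t∈ c′∈K }) (one c∈K c′∈K c≢c′ (NonNeighbours.∈⇒missing class t∈)))

    ≁own : ∀ {t} → t ∈ xs → ¬ Adj G c t
    ≁own t∈ a = proj₂ (NonNeighbours.∈⇒missing class t∈) (Adj-sym G a)

  module A = Class v̂∈K A-class
  module B = Class û∈K B-class
  module D = Class ŵ∈K D-class

  û~A : ∀ {x} → x ∈ A → Adj G û x
  û~A = A.~other û∈K (adj⇒≢ G v̂~û)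
  ŵ~A : ∀ {x} → x ∈ A → Adj G ŵ x
  ŵ~A = A.~other ŵ∈K (adj⇒≢ G v̂ŵ)
  v̂~B : ∀ {x} → x ∈ B → Adj G v̂ x
  v̂~B = B.~other v̂∈K (adj⇒≢ G ûv̂)
  ŵ~B : ∀ {x} → x ∈ B → Adj G ŵ x
  ŵ~B = B.~other ŵ∈K (adj⇒≢ G ûŵ)
  û~D : ∀ {x} → x ∈ D → Adj G û x
  û~D = D.~other û∈K (adj⇒≢ G ŵ~û)
  v̂~D : ∀ {x} → x ∈ D → Adj G v̂ x
  v̂~D = D.~other v̂∈K (adj⇒≢ G ŵ~v̂)

  separated : ∀ {c x y} → Adj G c x → ¬ Adj G c y → x ≢ y
  separated a ¬a refl = ¬a a

  A~B : ∀ {x y} → x ∈ A → y ∈ B → Adj G x y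
  A~B x∈ y∈ = clique (A.∉K x∈) (B.∉K y∈) (separated (û~A x∈) (B.≁own y∈))
  A~D : ∀ {x y} → x ∈ A → y ∈ D → Adj G x y
  A~D x∈ y∈ = clique (A.∉K x∈) (D.∉K y∈) (separated (ŵ~A x∈) (D.≁own y∈))
  B~D : ∀ {x y} → x ∈ B → y ∈ D → Adj G x y
  B~D x∈ y∈ = clique (B.∉K x∈) (D.∉K y∈) (separated (ŵ~B x∈) (D.≁own y∈))

  covered : ∀ x → x ∈ K ++ A ++ B ++ D
  covered x with x ∈? K
  ... | yes x∈K = ∈-++⁺ˡ x∈K
  ... | no  x∉K with core-hit G free triangle x∉K
  ...   | _ , here refl , m                 = ∈-++⁺ʳ K (∈-++⁺ʳ A (∈-++⁺ˡ (NonNeighbours.missing⇒∈ B-class m)))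
  ...   | _ , there (here refl) , m         = ∈-++⁺ʳ K (∈-++⁺ˡ (NonNeighbours.missing⇒∈ A-class m))
  ...   | _ , there (there (here refl)) , m = ∈-++⁺ʳ K (∈-++⁺ʳ A (∈-++⁺ʳ B (NonNeighbours.missing⇒∈ D-class m)))

  order≤ : n ≤ 3 + (length A + (length B + length D))
  order≤ = subst₂ _≤_ (length-allFin n)
    (cong (3 +_) (trans (length-++ A) (cong (length A +_) (length-++ B))))
    (unique-⊆⇒length≤ (Unique.allFin⁺ n) λ {x} _ → covered x)

  -- Switching by κ makes the edges at ŵ positive; on D, where ŵ has no
  -- neighbour, it makes the edges at v̂ positive instead.
  κ : Fin n → Sign
  κ x = if adj G ŵ x then σ G ŵ x else σ G v̂ x · σ G ŵ v̂

  -- `ŵ` is not adjacent to itself, so the second branch of `κ` applies, and it is a square there.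
  κ-ŵ : κ ŵ ≡ ⊕
  κ-ŵ = trans (cong (if_then σ G ŵ ŵ else (σ G v̂ ŵ · σ G ŵ v̂)) (adj-irrefl G ŵ))
    (trans (cong (_· σ G ŵ v̂) (σ-sym G v̂ ŵ)) (s·s≡⊕ (σ G ŵ v̂)))

  κ-~ŵ : ∀ {x} → Adj G ŵ x → κ x ≡ σ G ŵ x
  κ-~ŵ {x} a = cong (if_then σ G ŵ x else (σ G v̂ x · σ G ŵ v̂)) (T⇒≡true a)

  κ-D : ∀ {x} → x ∈ D → κ x ≡ σ G v̂ x · σ G ŵ v̂
  κ-D {x} x∈ = cong (if_then σ G ŵ x else (σ G v̂ x · σ G ŵ v̂)) (¬T⇒≡false (D.≁own x∈))

  -- For an edge xy: positive (negative) after switching by κ.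
  Pos Neg : Fin n → Fin n → Set
  Pos x y = σ G x y ≡ κ x · κ y
  Neg x y = σ G x y ≡ opposite (κ x · κ y)

  pos-sym : ∀ {x y} → Pos x y → Pos y x
  pos-sym {x} {y} p = trans (σ-sym G y x) (trans p (·-comm (κ x) (κ y)))

  -- With `t` the triangle `xyz` lies in a `K₄`, hence is positive; two edges positive after
  -- switching force the third, as `κ y` cancels.
  pos-chain : ∀ {x y z t} → Adj G x y → Adj G y z → Adj G x z → Adj G t x → Adj G t y → Adj G t z →
    Pos x y → Pos y z → Pos x z
  pos-chain {x} {y} {z} xy yz xz tx ty tz p q = begin
    σ G x z                     ≡⟨ ⊕-last (σ G x y) (σ G y z) (K₄⇒tri≡⊕ G free xy yz xz tx ty tz) ⟩
    σ G x y · σ G y z           ≡⟨ cong₂ _·_ p q ⟩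
    κ x · κ y · (κ y · κ z)     ≡⟨ ·-assoc (κ x) (κ y) _ ⟩
    κ x · (κ y · (κ y · κ z))   ≡⟨ cong (κ x ·_) (·-cancel (κ y) (κ z)) ⟩
    κ x · κ z                   ∎
    where open ≡-Reasoning

  pos-ŵ : ∀ {x} → Adj G ŵ x → Pos ŵ x
  pos-ŵ {x} a = trans (sym (κ-~ŵ a)) (cong (_· κ x) (sym κ-ŵ))

  -- The chain through `ŵ`, whose edges `κ` has made positive.
  pos-common : ∀ {x y t} → Adj G ŵ x → Adj G ŵ y → Adj G x y → Adj G t ŵ → Adj G t x → Adj G t y → Pos x y
  pos-common ŵx ŵy xy tŵ tx ty =
    pos-chain (Adj-sym G ŵx) ŵy xy tx tŵ ty (pos-sym (pos-ŵ ŵx)) (pos-ŵ ŵy)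

  -- Both edges of the triangle at `ŵ` are positive after switching, so the negative sign falls on
  -- the third edge.
  neg-ûv̂ : Neg û v̂
  neg-ûv̂ = trans (first (σ G û v̂) (σ G v̂ ŵ) (σ G û ŵ) tri⊖)
    (cong₂ (λ s t → opposite (s · t))
      (trans (σ-sym G û ŵ) (sym (κ-~ŵ ŵ~û))) (trans (σ-sym G v̂ ŵ) (sym (κ-~ŵ ŵ~v̂))))
    where
    first : ∀ a b c → a · b · c ≡ ⊖ → a ≡ opposite (c · b)
    first ⊕ ⊕ ⊖ _ = refl
    first ⊕ ⊖ ⊕ _ = refl
    first ⊖ ⊕ ⊕ _ = refl
    first ⊖ ⊖ ⊖ _ = refl

  pos-v̂D : ∀ {d} → d ∈ D → Pos v̂ d
  pos-v̂D {d} d∈ = sym (begin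
    κ v̂ · κ d                            ≡⟨ cong₂ _·_ (κ-~ŵ ŵ~v̂) (trans (κ-D d∈) (·-comm (σ G v̂ d) _)) ⟩
    σ G ŵ v̂ · (σ G ŵ v̂ · σ G v̂ d)        ≡⟨ ·-cancel (σ G ŵ v̂) _ ⟩
    σ G v̂ d                              ∎)
    where open ≡-Reasoning

  AB-unique : Unique (A ++ B)
  AB-unique = Unique.++⁺ (NonNeighbours.unique A-class) (NonNeighbours.unique B-class)
    λ (x∈A , x∈B) → separated (û~A x∈A) (B.≁own x∈B) refl

  ŵ~AB : ∀ {x} → x ∈ A ++ B → Adj G ŵ x
  ŵ~AB x∈ with ∈-++⁻ A x∈
  ... | inj₁ x∈A = ŵ~A x∈A
  ... | inj₂ x∈B = ŵ~B x∈B

  AB-∉K : ∀ {x} → x ∈ A ++ B → x ∉ K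
  AB-∉K x∈ with ∈-++⁻ A x∈
  ... | inj₁ x∈A = A.∉K x∈A
  ... | inj₂ x∈B = B.∉K x∈B

  -- Provides a fourth vertex for a `K₄`: members of one class are mutually adjacent and have the
  -- same neighbours in the triangle.
  another : ∀ {c xs} (c∈K : c ∈ K) → NonNeighbours G free c xs → 2 ≤ length xs →
    ∀ {x} → x ∈ xs → ∃[ t ] (t ∈ xs × Adj G t x)
  another c∈K class 2≤ {x} x∈ with avoid (x ∷ []) (NonNeighbours.unique class) 2≤
  ... | t , t∈ , t∉ = t , t∈ , clique (Class.∉K c∈K class t∈) (Class.∉K c∈K class x∈) (t∉ ∘ here)

  module _ (3≤AB : 3 ≤ length A + length B) where

    -- A third vertex `t` of the two classes makes `ŵ`, `x`, `y`, `t` a `K₄`; hence the bound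
    -- `3 ≤ length A + length B`.
    pos-AB : ∀ {x y} → x ∈ A ++ B → y ∈ A ++ B → x ≢ y → Pos x y
    pos-AB {x} {y} x∈ y∈ x≢y with avoid (x ∷ y ∷ []) AB-unique (subst (3 ≤_) (sym (length-++ A)) 3≤AB)
    ... | t , t∈ , t∉ = pos-common (ŵ~AB x∈) (ŵ~AB y∈)
      (clique (AB-∉K x∈) (AB-∉K y∈) x≢y) (Adj-sym G (ŵ~AB t∈))
      (clique (AB-∉K t∈) (AB-∉K x∈) (t∉ ∘ here)) (clique (AB-∉K t∈) (AB-∉K y∈) (t∉ ∘ there ∘ here))

    pos-A-B : ∀ {a b} → a ∈ A → b ∈ B → Pos a b
    pos-A-B a∈ b∈ = pos-AB (∈-++⁺ˡ a∈) (∈-++⁺ʳ A b∈) (adj⇒≢ G (A~B a∈ b∈))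

    module _ (2≤B : 2 ≤ length B) where

      -- A second vertex `t` of `B` completes `v̂`, `ŵ`, `b` to a `K₄`.
      pos-v̂B : ∀ {b} → b ∈ B → Pos v̂ b
      pos-v̂B b∈ with another û∈K B-class 2≤B b∈
      ... | t , t∈ , tb = pos-common ŵ~v̂ (ŵ~B b∈) (v̂~B b∈) (Adj-sym G (ŵ~B t∈)) (Adj-sym G (v̂~B t∈)) tb

      -- As `ŵ` misses `d`, the chain runs through `v̂`; a second vertex of `B` is the fourth one.
      pos-BD : ∀ {b d} → b ∈ B → d ∈ D → Pos b d
      pos-BD b∈ d∈ with another û∈K B-class 2≤B b∈
      ... | t , t∈ , tb = pos-chain (Adj-sym G (v̂~B b∈)) (v̂~D d∈) (B~D b∈ d∈) tb (Adj-sym G (v̂~B t∈)) (B~D t∈ d∈)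
        (pos-sym (pos-v̂B b∈)) (pos-v̂D d∈)

      -- Two vertices of `B` serve as the middle of the chain and the fourth vertex, so `A` may be a
      -- singleton.
      pos-AD : ∀ {a d} → a ∈ A → d ∈ D → Pos a d
      pos-AD a∈ d∈ with avoid [] (NonNeighbours.unique B-class) (≤-trans (s≤s z≤n) 2≤B)
      ... | b , b∈ , _ with another û∈K B-class 2≤B b∈
      ...   | t , t∈ , tb = pos-chain (A~B a∈ b∈) (B~D b∈ d∈) (A~D a∈ d∈) (Adj-sym G (A~B a∈ t∈)) tb (B~D t∈ d∈)
        (pos-A-B a∈ b∈) (pos-BD b∈ d∈)

      module _ (2≤A : 2 ≤ length A) where

        pos-ûA : ∀ {a} → a ∈ A → Pos û a
        pos-ûA a∈ with another v̂∈K A-class 2≤A a∈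
        ... | t , t∈ , ta = pos-common ŵ~û (ŵ~A a∈) (û~A a∈) (Adj-sym G (ŵ~A t∈)) (Adj-sym G (û~A t∈)) ta

        -- The chain runs from `û` through one vertex of `A`, and a second vertex of `A` completes
        -- the `K₄`.
        pos-ûD : ∀ {d} → d ∈ D → Pos û d
        pos-ûD d∈ with avoid [] (NonNeighbours.unique A-class) (≤-trans (s≤s z≤n) 2≤A)
        ... | a , a∈ , _ with another v̂∈K A-class 2≤A a∈
        ...   | t , t∈ , ta = pos-chain (û~A a∈) (A~D a∈ d∈) (û~D d∈) (Adj-sym G (û~A t∈)) ta (A~D t∈ d∈)
          (pos-ûA a∈) (pos-AD a∈ d∈)

        -- Two vertices of `D` form a `K₄` with `û` and `v̂`, and the chain through one of them
        -- makes `ûv̂` positive, against `neg-ûv̂`.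
        D-small : ¬ 2 ≤ length D
        D-small 2≤D with avoid [] (NonNeighbours.unique D-class) (≤-trans (s≤s z≤n) 2≤D)
        ... | d , d∈ , _ with another ŵ∈K D-class 2≤D d∈
        ...   | t , t∈ , td = s≢opposite[s] _ (trans (sym pos-ûv̂) neg-ûv̂)
          where
          pos-ûv̂ : Pos û v̂
          pos-ûv̂ = pos-chain (û~D d∈) (Adj-sym G (v̂~D d∈)) ûv̂ (Adj-sym G (û~D t∈)) td (Adj-sym G (v̂~D t∈))
            (pos-ûD d∈) (pos-sym (pos-v̂D d∈))

-- Isomorphisms onto the family

-- The map `f` starts at the family member, so that comparisons go by cases on its named vertices;
-- the isomorphism is the inverse of `f`.
module Transfer {V W : Set} (G : SignedGraph V) (κ : V → Sign) (Γ : Graph W) (N : W → W → Bool) (f : W → V) where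

  label : W → W → Sign
  label p q = if N p q ∨ N q p then ⊖ else ⊕

  data Match (p q : W) : Set where
    same : p ≡ q → Match p q
    edge : Adj G (f p) (f q) → Graph.adj Γ p q ≡ true →
           σ G (f p) (f q) ≡ label p q · (κ (f p) · κ (f q)) → Match p q
    miss : Missing G (f p) (f q) → Graph.adj Γ p q ≡ false → Match p q

  match-sym : ∀ {p q} → Match p q → Match q p
  match-sym (same eq) = same (sym eq)
  match-sym {p} {q} (edge a b s) = edge (Adj-sym G a) (trans (Graph.adj-sym Γ q p) b)
    (trans (σ-sym G (f q) (f p)) (trans s
      (cong₂ (λ c t → (if c then ⊖ else ⊕) · t) (∨-comm (N p q) (N q p)) (·-comm (κ (f p)) _))))
  match-sym {p} {q} (miss m b) = miss (missing-sym G m) (trans (Graph.adj-sym Γ q p) b)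

  isNegative : Sign → Bool
  isNegative ⊖ = true
  isNegative ⊕ = false

  -- Switching at the vertices where `κ` is negative multiplies an edge sign by the `κ`-values of
  -- both ends, cancelling the factor `a · b`.
  unswitch : ∀ a b t → (if isNegative a xor isNegative b then opposite (t · (a · b)) else t · (a · b)) ≡ t
  unswitch ⊕ ⊕ ⊕ = refl
  unswitch ⊕ ⊕ ⊖ = refl
  unswitch ⊕ ⊖ ⊕ = refl
  unswitch ⊕ ⊖ ⊖ = refl
  unswitch ⊖ ⊕ ⊕ = refl
  unswitch ⊖ ⊕ ⊖ = refl
  unswitch ⊖ ⊖ ⊕ = refl
  unswitch ⊖ ⊖ ⊖ = refl

  module _ (match : ∀ p q → Match p q) (surjective : ∀ x → ∃[ p ] f p ≡ x) where

    -- Both `edge` and `miss` force distinct images, which leaves `same`.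
    injective : ∀ {p q} → f p ≡ f q → p ≡ q
    injective {p} {q} eq with match p q
    ... | same p≡q = p≡q
    ... | edge a _ _ = contradiction eq (adj⇒≢ G a)
    ... | miss m _ = contradiction eq (proj₁ m)

    adj-match : ∀ p q → adj G (f p) (f q) ≡ Graph.adj Γ p q
    adj-match p q with match p q
    ... | same refl = trans (adj-irrefl G (f p)) (sym (Graph.adj-irrefl Γ p))
    ... | edge a b _ = trans (T⇒≡true a) (sym b)
    ... | miss m b = trans (¬T⇒≡false (proj₂ m)) (sym b)

    σ-match : ∀ p q → Adj G (f p) (f q) → σ G (f p) (f q) ≡ label p q · (κ (f p) · κ (f q))
    σ-match p q a with match p q
    ... | same refl = contradiction refl (adj⇒≢ G a)
    ... | edge _ _ s = s
    ... | miss m _ = contradiction a (proj₂ m)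

    bijection : V ↔ W
    bijection = mk↔ₛ′ (proj₁ ∘ surjective) f
      (λ p → injective (proj₂ (surjective (f p)))) (proj₂ ∘ surjective)

    transfer : G ∼ negateOn N Γ
    transfer = (isNegative ∘ κ) , record
      { bijection = bijection
      ; adj-≡     = λ x y → trans
          (cong₂ (adj G) (sym (proj₂ (surjective x))) (sym (proj₂ (surjective y))))
          (adj-match _ _)
      ; sign-≡    = λ {x} {y} a _ → switched (surjective x) (surjective y) a
      }
      where
      -- The preimages are arguments here so that matching on `refl` turns `x` and `y` into values
      -- of `f`.
      switched : ∀ {x y} (x′ : ∃[ p ] f p ≡ x) (y′ : ∃[ q ] f q ≡ y) (a : Adj G x y) →
        sign (switch (isNegative ∘ κ) G) a ≡ label (proj₁ x′) (proj₁ y′)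
      switched (p , refl) (q , refl) a = trans
        (cong (λ s → if isNegative (κ (f p)) xor isNegative (κ (f q)) then opposite s else s)
          (trans (sign≡σ G a) (σ-match p q a)))
        (unswitch (κ (f p)) (κ (f q)) (label p q))

-- Used for two members of one class: the non-edge table computes to `false` there, but the equality
-- test does not reduce by itself.
≢⇒adj : ∀ {k a b} (p q : Vertex k a b) → p ≢ q → not (does (p ≟ q)) ∧ true ≡ true
≢⇒adj p q p≢q = cong (λ b → not b ∧ true) (dec-false (p ≟ q) p≢q)

module Isomorphisms {n} (G : SignedGraph (Fin n)) (free : 𝒦₄⁻-Free G) {û v̂ ŵ} (extreme : Extremal G free û v̂ ŵ)
  {A B D} (A-class : NonNeighbours G free v̂ A) (B-class : NonNeighbours G free û B)
  (D-class : NonNeighbours G free ŵ D)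
  (3≤AB : 3 ≤ length A + length B) (2≤B : 2 ≤ length B) where

  open Signs G free extreme A-class B-class D-class
  open Extremal extreme
  open NegativeTriangle triangle renaming (xy to ûv̂; yz to v̂ŵ; xz to ûŵ)

  missing-A : ∀ {x} → x ∈ A → Missing G v̂ x
  missing-A = missing-sym G ∘ NonNeighbours.∈⇒missing A-class
  missing-B : ∀ {x} → x ∈ B → Missing G û x
  missing-B = missing-sym G ∘ NonNeighbours.∈⇒missing B-class
  missing-D : ∀ {x} → x ∈ D → Missing G ŵ x
  missing-D = missing-sym G ∘ NonNeighbours.∈⇒missing D-class

  a∈ : ∀ i → lookup A i ∈ A
  a∈ i = ∈-lookup i
  b∈ : ∀ i → lookup B i ∈ B
  b∈ i = ∈-lookup i

  -- The switched sign of the edge joining p to q is the one that N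
  -- prescribes, provided that N q p is false.
  Labelled : {W : Set} → (W → W → Bool) → (W → Fin n) → W → W → Set
  Labelled N f p q = (N p q ≡ false × Pos (f p) (f q)) ⊎ (N p q ≡ true × Neg (f p) (f q))

  -- Abstract in `Γ`, `N` and `f`, to serve both underlying graphs of the family.
  module Labelling {k} (Γ : Graph (Vertex k (length A) (length B)))
    (N : Vertex k (length A) (length B) → Vertex k (length A) (length B) → Bool)
    (f : Vertex k (length A) (length B) → Fin n) where

    open Transfer G κ Γ N f

    edge⁺ : ∀ {p q} → N p q ≡ false → N q p ≡ false → Adj G (f p) (f q) → Pos (f p) (f q) →
      Graph.adj Γ p q ≡ true → Match p q
    edge⁺ {p} {q} pq qp a pos b = edge a b
      (trans pos (cong₂ (λ c d → (if c ∨ d then ⊖ else ⊕) · (κ (f p) · κ (f q))) (sym pq) (sym qp)))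

    edge⁻ : ∀ {p q} → N p q ≡ true → Adj G (f p) (f q) → Neg (f p) (f q) →
      Graph.adj Γ p q ≡ true → Match p q
    edge⁻ {p} {q} pq a neg b = edge a b
      (trans neg (cong (λ c → (if c ∨ N q p then ⊖ else ⊕) · (κ (f p) · κ (f q))) (sym pq)))

    edge± : ∀ {p q} → N q p ≡ false → Labelled N f p q → Adj G (f p) (f q) →
      Graph.adj Γ p q ≡ true → Match p q
    edge± qp (inj₁ (pq , pos)) a = edge⁺ pq qp a pos
    edge± qp (inj₂ (pq , neg)) a = edge⁻ pq a neg

    module _ (f-A : ∀ i → f (inA i) ≡ lookup A i) (N-A : ∀ i q → N (inA i) q ≡ false)
      (Γ-A : ∀ i j → i ≢ j → Graph.adj Γ (inA i) (inA j) ≡ true) where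

      match-AA : ∀ i j → Match (inA i) (inA j)
      match-AA i j with i Fin.≟ j
      ... | yes refl = same refl
      ... | no  i≢j  = edge⁺ (N-A i _) (N-A j _)
        (subst₂ (Adj G) (sym (f-A i)) (sym (f-A j)) (clique (A.∉K (a∈ i)) (A.∉K (a∈ j)) distinct))
        (subst₂ Pos (sym (f-A i)) (sym (f-A j)) (pos-AB 3≤AB (∈-++⁺ˡ (a∈ i)) (∈-++⁺ˡ (a∈ j)) distinct))
        (Γ-A i j i≢j)
        where
        distinct : lookup A i ≢ lookup A j
        distinct = i≢j ∘ lookup-injective (NonNeighbours.unique A-class)

    module _ (f-B : ∀ i → f (inB i) ≡ lookup B i) (N-B : ∀ i q → N (inB i) q ≡ false)
      (Γ-B : ∀ i j → i ≢ j → Graph.adj Γ (inB i) (inB j) ≡ true) where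

      match-BB : ∀ i j → Match (inB i) (inB j)
      match-BB i j with i Fin.≟ j
      ... | yes refl = same refl
      ... | no  i≢j  = edge⁺ (N-B i _) (N-B j _)
        (subst₂ (Adj G) (sym (f-B i)) (sym (f-B j)) (clique (B.∉K (b∈ i)) (B.∉K (b∈ j)) distinct))
        (subst₂ Pos (sym (f-B i)) (sym (f-B j)) (pos-AB 3≤AB (∈-++⁺ʳ A (b∈ i)) (∈-++⁺ʳ A (b∈ j)) distinct))
        (Γ-B i j i≢j)
        where
        distinct : lookup B i ≢ lookup B j
        distinct = i≢j ∘ lookup-injective (NonNeighbours.unique B-class)

  module OrderThree (D∅ : ∀ {x} → x ∉ D) where

    f₁ : Vertex 3 (length A) (length B) → Fin n
    f₁ u       = û
    f₁ v       = v̂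
    f₁ w       = ŵ
    f₁ (inA i) = lookup A i
    f₁ (inB i) = lookup B i

    f₁-surjective : ∀ x → ∃[ p ] f₁ p ≡ x
    f₁-surjective x with ∈-++⁻ K (covered x)
    ... | inj₁ (here refl)                 = u , refl
    ... | inj₁ (there (here refl))         = v , refl
    ... | inj₁ (there (there (here refl))) = w , refl
    ... | inj₂ x∈ with ∈-++⁻ A x∈
    ...   | inj₁ x∈A = inA (index x∈A) , sym (lookup-index x∈A)
    ...   | inj₂ x∈BD with ∈-++⁻ B x∈BD
    ...     | inj₁ x∈B = inB (index x∈B) , sym (lookup-index x∈B)
    ...     | inj₂ x∈D = contradiction x∈D D∅

    -- Every negative pair of the family is listed from `u`, so the members on `Γ₁` differ only in
    -- the values of `N` from `u` to `A`, left open by `N-uA`.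
    module _ {N : Vertex 3 (length A) (length B) → Vertex 3 (length A) (length B) → Bool}
      (N-u : ∀ p q → p ≢ u → N p q ≡ false) (N-uv : N u v ≡ true) (N-uw : N u w ≡ false)
      (N-uA : ∀ i → Labelled N f₁ u (inA i)) where

      open Transfer G κ (Γ₁ (length A) (length B)) N f₁
      open Labelling (Γ₁ (length A) (length B)) N f₁

      positive : ∀ {p q} → p ≢ u → q ≢ u → Adj G (f₁ p) (f₁ q) → Pos (f₁ p) (f₁ q) →
        Graph.adj (Γ₁ (length A) (length B)) p q ≡ true → Match p q
      positive {p} {q} p≢u q≢u = edge⁺ (N-u p q p≢u) (N-u q p q≢u)

      match-uv : Match u v
      match-uv = edge⁻ N-uv ûv̂ neg-ûv̂ refl
      match-uw : Match u w
      match-uw = edge⁺ N-uw (N-u w u λ ()) ûŵ (pos-sym (pos-ŵ ŵ~û)) refl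
      match-uA : ∀ i → Match u (inA i)
      match-uA i = edge± (N-u _ u λ ()) (N-uA i) (û~A (a∈ i)) refl
      match-uB : ∀ j → Match u (inB j)
      match-uB j = miss (missing-B (b∈ j)) refl
      match-vw : Match v w
      match-vw = positive (λ ()) (λ ()) v̂ŵ (pos-sym (pos-ŵ ŵ~v̂)) refl
      match-vA : ∀ i → Match v (inA i)
      match-vA i = miss (missing-A (a∈ i)) refl
      match-vB : ∀ j → Match v (inB j)
      match-vB j = positive (λ ()) (λ ()) (v̂~B (b∈ j)) (pos-v̂B 3≤AB 2≤B (b∈ j)) refl
      match-wA : ∀ i → Match w (inA i)
      match-wA i = positive (λ ()) (λ ()) (ŵ~A (a∈ i)) (pos-ŵ (ŵ~A (a∈ i))) refl
      match-wB : ∀ j → Match w (inB j)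
      match-wB j = positive (λ ()) (λ ()) (ŵ~B (b∈ j)) (pos-ŵ (ŵ~B (b∈ j))) refl
      match-AB : ∀ i j → Match (inA i) (inB j)
      match-AB i j = positive (λ ()) (λ ()) (A~B (a∈ i) (b∈ j)) (pos-A-B 3≤AB (a∈ i) (b∈ j)) refl

      match : ∀ p q → Match p q
      match u u = same refl
      match u v = match-uv
      match u w = match-uw
      match u (inA i) = match-uA i
      match u (inB j) = match-uB j
      match v u = match-sym match-uv
      match v v = same refl
      match v w = match-vw
      match v (inA i) = match-vA i
      match v (inB j) = match-vB j
      match w u = match-sym match-uw
      match w v = match-sym match-vw
      match w w = same refl
      match w (inA i) = match-wA i
      match w (inB j) = match-wB j
      match (inA i) u = match-sym (match-uA i)
      match (inA i) v = match-sym (match-vA i)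
      match (inA i) w = match-sym (match-wA i)
      match (inA i) (inA j) = match-AA (λ _ → refl) (λ i q → N-u (inA i) q λ ())
        (λ i j i≢j → ≢⇒adj {3} {length A} {length B} (inA i) (inA j) λ { refl → i≢j refl }) i j
      match (inA i) (inB j) = match-AB i j
      match (inB j) u = match-sym (match-uB j)
      match (inB j) v = match-sym (match-vB j)
      match (inB j) w = match-sym (match-wB j)
      match (inB j) (inA i) = match-sym (match-AB i j)
      match (inB i) (inB j) = match-BB (λ _ → refl) (λ i q → N-u (inB i) q λ ())
        (λ i j i≢j → ≢⇒adj {3} {length A} {length B} (inB i) (inB j) λ { refl → i≢j refl }) i j

      ∼-Γ₁ : G ∼ negateOn N (Γ₁ (length A) (length B))
      ∼-Γ₁ = transfer match f₁-surjective

  module OrderFour {d} (d∈ : d ∈ D) (D-single : ∀ {x} → x ∈ D → x ≡ d) where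

    f₂ : Vertex 4 (length A) (length B) → Fin n
    f₂ u       = û
    f₂ v       = v̂
    f₂ w       = ŵ
    f₂ w₁      = d
    f₂ (inA i) = lookup A i
    f₂ (inB i) = lookup B i

    f₂-surjective : ∀ x → ∃[ p ] f₂ p ≡ x
    f₂-surjective x with ∈-++⁻ K (covered x)
    ... | inj₁ (here refl)                 = u , refl
    ... | inj₁ (there (here refl))         = v , refl
    ... | inj₁ (there (there (here refl))) = w , refl
    ... | inj₂ x∈ with ∈-++⁻ A x∈
    ...   | inj₁ x∈A = inA (index x∈A) , sym (lookup-index x∈A)
    ...   | inj₂ x∈BD with ∈-++⁻ B x∈BD
    ...     | inj₁ x∈B = inB (index x∈B) , sym (lookup-index x∈B)
    ...     | inj₂ x∈D = w₁ , sym (D-single x∈D)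

    -- On `Γ₂` the values of `N` left open are those from `u` to `w₁` and from `u` to `A`.
    module _ {N : Vertex 4 (length A) (length B) → Vertex 4 (length A) (length B) → Bool}
      (N-u : ∀ p q → p ≢ u → N p q ≡ false) (N-uv : N u v ≡ true) (N-uw : N u w ≡ false)
      (N-uw₁ : Labelled N f₂ u w₁) (N-uA : ∀ i → Labelled N f₂ u (inA i)) where

      open Transfer G κ (Γ₂ (length A) (length B)) N f₂
      open Labelling (Γ₂ (length A) (length B)) N f₂

      positive : ∀ {p q} → p ≢ u → q ≢ u → Adj G (f₂ p) (f₂ q) → Pos (f₂ p) (f₂ q) →
        Graph.adj (Γ₂ (length A) (length B)) p q ≡ true → Match p q
      positive {p} {q} p≢u q≢u = edge⁺ (N-u p q p≢u) (N-u q p q≢u)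

      match-uv : Match u v
      match-uv = edge⁻ N-uv ûv̂ neg-ûv̂ refl
      match-uw : Match u w
      match-uw = edge⁺ N-uw (N-u w u λ ()) ûŵ (pos-sym (pos-ŵ ŵ~û)) refl
      match-uw₁ : Match u w₁
      match-uw₁ = edge± (N-u _ u λ ()) N-uw₁ (û~D d∈) refl
      match-uA : ∀ i → Match u (inA i)
      match-uA i = edge± (N-u _ u λ ()) (N-uA i) (û~A (a∈ i)) refl
      match-uB : ∀ j → Match u (inB j)
      match-uB j = miss (missing-B (b∈ j)) refl
      match-vw : Match v w
      match-vw = positive (λ ()) (λ ()) v̂ŵ (pos-sym (pos-ŵ ŵ~v̂)) refl
      match-vw₁ : Match v w₁
      match-vw₁ = positive (λ ()) (λ ()) (v̂~D d∈) (pos-v̂D d∈) refl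
      match-vA : ∀ i → Match v (inA i)
      match-vA i = miss (missing-A (a∈ i)) refl
      match-vB : ∀ j → Match v (inB j)
      match-vB j = positive (λ ()) (λ ()) (v̂~B (b∈ j)) (pos-v̂B 3≤AB 2≤B (b∈ j)) refl
      match-ww₁ : Match w w₁
      match-ww₁ = miss (missing-D d∈) refl
      match-wA : ∀ i → Match w (inA i)
      match-wA i = positive (λ ()) (λ ()) (ŵ~A (a∈ i)) (pos-ŵ (ŵ~A (a∈ i))) refl
      match-wB : ∀ j → Match w (inB j)
      match-wB j = positive (λ ()) (λ ()) (ŵ~B (b∈ j)) (pos-ŵ (ŵ~B (b∈ j))) refl
      match-Aw₁ : ∀ i → Match (inA i) w₁
      match-Aw₁ i = positive (λ ()) (λ ()) (A~D (a∈ i) d∈) (pos-AD 3≤AB 2≤B (a∈ i) d∈) refl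
      match-Bw₁ : ∀ j → Match (inB j) w₁
      match-Bw₁ j = positive (λ ()) (λ ()) (B~D (b∈ j) d∈) (pos-BD 3≤AB 2≤B (b∈ j) d∈) refl
      match-AB : ∀ i j → Match (inA i) (inB j)
      match-AB i j = positive (λ ()) (λ ()) (A~B (a∈ i) (b∈ j)) (pos-A-B 3≤AB (a∈ i) (b∈ j)) refl

      match : ∀ p q → Match p q
      match u u = same refl
      match u v = match-uv
      match u w = match-uw
      match u w₁ = match-uw₁
      match u (inA i) = match-uA i
      match u (inB j) = match-uB j
      match v u = match-sym match-uv
      match v v = same refl
      match v w = match-vw
      match v w₁ = match-vw₁
      match v (inA i) = match-vA i
      match v (inB j) = match-vB j
      match w u = match-sym match-uw
      match w v = match-sym match-vw
      match w w = same refl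
      match w w₁ = match-ww₁
      match w (inA i) = match-wA i
      match w (inB j) = match-wB j
      match w₁ u = match-sym match-uw₁
      match w₁ v = match-sym match-vw₁
      match w₁ w = match-sym match-ww₁
      match w₁ w₁ = same refl
      match w₁ (inA i) = match-sym (match-Aw₁ i)
      match w₁ (inB j) = match-sym (match-Bw₁ j)
      match (inA i) u = match-sym (match-uA i)
      match (inA i) v = match-sym (match-vA i)
      match (inA i) w = match-sym (match-wA i)
      match (inA i) w₁ = match-Aw₁ i
      match (inA i) (inA j) = match-AA (λ _ → refl) (λ i q → N-u (inA i) q λ ())
        (λ i j i≢j → ≢⇒adj {4} {length A} {length B} (inA i) (inA j) λ { refl → i≢j refl }) i j
      match (inA i) (inB j) = match-AB i j
      match (inB j) u = match-sym (match-uB j)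
      match (inB j) v = match-sym (match-vB j)
      match (inB j) w = match-sym (match-wB j)
      match (inB j) w₁ = match-Bw₁ j
      match (inB j) (inA i) = match-sym (match-AB i j)
      match (inB i) (inB j) = match-BB (λ _ → refl) (λ i q → N-u (inB i) q λ ())
        (λ i j i≢j → ≢⇒adj {4} {length A} {length B} (inB i) (inB j) λ { refl → i≢j refl }) i j

      ∼-Γ₂ : G ∼ negateOn N (Γ₂ (length A) (length B))
      ∼-Γ₂ = transfer match f₂-surjective

-- Classification of the extremal graphs

order : ∀ {n k a b} → Fin n ↔ Vertex k a b → n ≡ k + (a + b)
order i = ↔⇒≡ (↔-trans i (↔-trans (↔-refl ⊎-↔ (↔-sym +↔⊎)) (↔-sym +↔⊎)))

∼⇒order : ∀ {n k a b} {G : SignedGraph (Fin n)} {H : SignedGraph (Vertex k a b)} → G ∼ H → n ≡ k + (a + b)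
∼⇒order (_ , iso) = order (_≅_.bijection iso)

parity : ∀ s t → s ≡ t ⊎ s ≡ opposite t
parity ⊕ ⊕ = inj₁ refl
parity ⊕ ⊖ = inj₂ refl
parity ⊖ ⊕ = inj₂ refl
parity ⊖ ⊖ = inj₁ refl

InFamily : ∀ {n} → SignedGraph (Fin n) → Set₁
InFamily {n} G = Σ[ W ∈ Set ] Σ[ H ∈ SignedGraph W ] (𝒢 n H × (G ∼ H))

module _ {n} {G : SignedGraph (Fin n)} where

  -- The isomorphism determines the order, so the arithmetic conditions of `𝒢` follow from it, here
  -- and in the lemmas below.
  member₁ : ∀ {a b} → G ∼ Ġ₁ a b → InFamily G
  member₁ {a} {b} iso = _ , _ , g₁ a b (cong (_∸ 3) (sym (∼⇒order iso))) , iso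

  member₁′ : ∀ {b} → G ∼ Ġ₁′ b → InFamily G
  member₁′ iso = _ , _ , g₁′ , subst (λ b → G ∼ Ġ₁′ b) (cong (_∸ 4) (sym (∼⇒order iso))) iso

  member₂ : ∀ {c d} → 1 ≤ c → 1 ≤ d → G ∼ Ġ₂ c d → InFamily G
  member₂ {c} {d} 1≤c 1≤d iso = _ , _ , g₂ c d (cong (_∸ 4) (sym (∼⇒order iso))) 1≤c 1≤d , iso

  member₃ : ∀ {d} → G ∼ Ġ₃ d → InFamily G
  member₃ iso = _ , _ , g₃ , subst (λ d → G ∼ Ġ₃ d) (cong (_∸ 5) (sym (∼⇒order iso))) iso

  member₄ : ∀ {d} → G ∼ Ġ₄ d → InFamily G
  member₄ iso = _ , _ , g₄ , subst (λ d → G ∼ Ġ₄ d) (cong (_∸ 5) (sym (∼⇒order iso))) iso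

  member₅ : ∀ {d} → G ∼ Ġ₅ d → InFamily G
  member₅ iso = _ , _ , g₅ , subst (λ d → G ∼ Ġ₅ d) (cong (_∸ 5) (sym (∼⇒order iso))) iso

module _ {n} (G : SignedGraph (Fin n)) (free : 𝒦₄⁻-Free G) {û v̂ ŵ} (extreme : Extremal G free û v̂ ŵ) where

  -- The hypothesis `length D ≤ length A` excludes an empty `A` beside a non-empty `D`, and when `D`
  -- has two vertices it provides the second vertex of `A` that `D-small` asks for.
  classify : ∀ {A B D} → NonNeighbours G free v̂ A → NonNeighbours G free û B → NonNeighbours G free ŵ D →
    3 ≤ length A + length B → 2 ≤ length B → length D ≤ length A → InFamily G
  classify {A} {B} {[]} cA cB cD 3≤AB 2≤B _ = order₃ A cA 3≤AB
    where
    order₃ : ∀ A → NonNeighbours G free v̂ A → 3 ≤ length A + length B → InFamily G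
    order₃ [] cA 3≤AB = member₁ (∼-Γ₁
      (λ { u _ u≢u → contradiction refl u≢u ; (inj₁ (suc _)) _ _ → refl ; (inj₂ _) _ _ → refl })
      refl refl (λ ()))
      where open Isomorphisms.OrderThree G free extreme cA cB cD 3≤AB 2≤B ¬Any[]
    -- The neighbours of `û` are `v̂`, `ŵ` and `a`, and `v̂` misses `a`, so no `K₄` contains `ûa`:
    -- either sign may occur.
    order₃ (a ∷ []) cA 3≤AB
      with parity (σ G û a) (Signs.κ G free extreme cA cB cD û · Signs.κ G free extreme cA cB cD a)
    ... | inj₁ pos = member₁ (∼-Γ₁
      (λ { u _ u≢u → contradiction refl u≢u ; (inj₁ (suc _)) _ _ → refl ; (inj₂ _) _ _ → refl })
      refl refl (λ { zero → inj₁ (refl , pos) }))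
      where open Isomorphisms.OrderThree G free extreme cA cB cD 3≤AB 2≤B ¬Any[]
    ... | inj₂ neg = member₁′ (∼-Γ₁
      (λ { u _ u≢u → contradiction refl u≢u ; (inj₁ (suc _)) _ _ → refl ; (inj₂ _) _ _ → refl })
      refl refl (λ { zero → inj₂ (refl , neg) }))
      where open Isomorphisms.OrderThree G free extreme cA cB cD 3≤AB 2≤B ¬Any[]
    order₃ A@(_ ∷ _ ∷ _) cA 3≤AB = member₁ (∼-Γ₁
      (λ { u _ u≢u → contradiction refl u≢u ; (inj₁ (suc _)) _ _ → refl ; (inj₂ _) _ _ → refl })
      refl refl (λ i → inj₁ (refl , Signs.pos-ûA G free extreme cA cB cD 3≤AB 2≤B (s≤s (s≤s z≤n)) (∈-lookup i))))
      where open Isomorphisms.OrderThree G free extreme cA cB cD 3≤AB 2≤B ¬Any[]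
  classify {[]} {D = _ ∷ []} _ _ _ _ _ ()
  -- The neighbours of `û` are `v̂`, `ŵ`, `a` and `d`. As `v̂` misses `a` and `ŵ` misses `d`, no
  -- `K₄` contains `û`, and the signs of `ûd` and `ûa` are independent: four cases.
  classify {a ∷ []} {B} {d ∷ []} cA cB cD 3≤AB 2≤B _
    with parity (σ G û d) (Signs.κ G free extreme cA cB cD û · Signs.κ G free extreme cA cB cD d)
       | parity (σ G û a) (Signs.κ G free extreme cA cB cD û · Signs.κ G free extreme cA cB cD a)
  ... | inj₁ pos | inj₁ pos′ = member₂ (s≤s z≤n) (≤-trans (s≤s z≤n) 2≤B) (∼-Γ₂
      (λ { u _ u≢u → contradiction refl u≢u ; (inj₁ (suc _)) _ _ → refl ; (inj₂ _) _ _ → refl })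
      refl refl (inj₁ (refl , pos)) (λ { zero → inj₁ (refl , pos′) }))
      where open Isomorphisms.OrderFour G free extreme cA cB cD 3≤AB 2≤B (here refl) ∈-singleton⁻
  ... | inj₁ pos | inj₂ neg = member₃ (∼-Γ₂
      (λ { u _ u≢u → contradiction refl u≢u ; (inj₁ (suc _)) _ _ → refl ; (inj₂ _) _ _ → refl })
      refl refl (inj₁ (refl , pos)) (λ { zero → inj₂ (refl , neg) }))
      where open Isomorphisms.OrderFour G free extreme cA cB cD 3≤AB 2≤B (here refl) ∈-singleton⁻
  ... | inj₂ neg | inj₁ pos = member₄ (∼-Γ₂
      (λ { u _ u≢u → contradiction refl u≢u ; (inj₁ (suc _)) _ _ → refl ; (inj₂ _) _ _ → refl })
      refl refl (inj₂ (refl , neg)) (λ { zero → inj₁ (refl , pos) }))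
      where open Isomorphisms.OrderFour G free extreme cA cB cD 3≤AB 2≤B (here refl) ∈-singleton⁻
  ... | inj₂ neg | inj₂ neg′ = member₅ (∼-Γ₂
      (λ { u _ u≢u → contradiction refl u≢u ; (inj₁ (suc _)) _ _ → refl ; (inj₂ _) _ _ → refl })
      refl refl (inj₂ (refl , neg)) (λ { zero → inj₂ (refl , neg′) }))
      where open Isomorphisms.OrderFour G free extreme cA cB cD 3≤AB 2≤B (here refl) ∈-singleton⁻
  classify {_ ∷ _ ∷ _} {B} {d ∷ []} cA cB cD 3≤AB 2≤B _ = member₂ (s≤s z≤n) (≤-trans (s≤s z≤n) 2≤B) (∼-Γ₂
      (λ { u _ u≢u → contradiction refl u≢u ; (inj₁ (suc _)) _ _ → refl ; (inj₂ _) _ _ → refl })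
      refl refl
      (inj₁ (refl , Signs.pos-ûD G free extreme cA cB cD 3≤AB 2≤B (s≤s (s≤s z≤n)) (here refl)))
      (λ i → inj₁ (refl , Signs.pos-ûA G free extreme cA cB cD 3≤AB 2≤B (s≤s (s≤s z≤n)) (∈-lookup i))))
      where open Isomorphisms.OrderFour G free extreme cA cB cD 3≤AB 2≤B (here refl) ∈-singleton⁻
  classify {D = _ ∷ _ ∷ _} cA cB cD 3≤AB 2≤B d≤a =
    contradiction (s≤s (s≤s z≤n)) (Signs.D-small G free extreme cA cB cD 3≤AB 2≤B (≤-trans (s≤s (s≤s z≤n)) d≤a))

-- Missing pairs of the family

module _ {n} (G : SignedGraph (Fin n)) where

  sort-< : ∀ {i j} → i < j → sort G (i , j) ≡ (i , j) × sort G (j , i) ≡ (i , j)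
  sort-< {i} {j} i<j with i <? j | j <? i
  ... | yes _  | yes j<i = contradiction i<j (<-asym j<i)
  ... | yes _  | no _    = refl , refl
  ... | no i≮j | _       = contradiction i<j i≮j

  -- Pulled back along the isomorphism and sorted, the pairs of `M` cover all of `nonEdges G`; hence
  -- `M` may list each pair in either orientation.
  nonEdges≤ : ∀ {W} {H : SignedGraph W} → G ∼ H → (M : List (W × W)) →
    (∀ p q → p ≢ q → adj H p q ≡ false → (p , q) ∈ M ⊎ (q , p) ∈ M) →
    length (nonEdges G) ≤ length M
  nonEdges≤ {W} {H} (_ , iso) M cover = subst (length (nonEdges G) ≤_) (length-map back M)
    (unique-⊆⇒length≤ (nonEdges-unique G) λ {(i , j)} → listed ∘ ∈-nonEdges⁻ G)
    where
    open _≅_ iso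
    open Inverse bijection using (from; strictlyInverseʳ)
    back : W × W → Fin n × Fin n
    back (p , q) = sort G (from p , from q)
    to-≢ : ∀ {i j} → i ≢ j → to i ≢ to j
    to-≢ i≢j eq = i≢j (trans (sym (strictlyInverseʳ _)) (trans (cong from eq) (strictlyInverseʳ _)))
    listed : ∀ {i j} → i < j × ¬ Adj G i j → (i , j) ∈ map back M
    listed {i} {j} (i<j , i≁j)
      with cover (to i) (to j) (to-≢ (Fin.<⇒≢ i<j)) (trans (sym (adj-≡ i j)) (¬T⇒≡false i≁j))
    ... | inj₁ p = subst (_∈ map back M)
      (trans (cong₂ (λ x y → sort G (x , y)) (strictlyInverseʳ i) (strictlyInverseʳ j)) (proj₁ (sort-< i<j)))
      (∈-map⁺ back p)
    ... | inj₂ p = subst (_∈ map back M)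
      (trans (cong₂ (λ x y → sort G (x , y)) (strictlyInverseʳ j) (strictlyInverseʳ i)) (proj₂ (sort-< i<j)))
      (∈-map⁺ back p)

module _ (a b : ℕ) where

  nonEdges-Γ₁ : List (Vertex 3 a b × Vertex 3 a b)
  nonEdges-Γ₁ = map (λ i → v , inA i) (allFin a) ++ map (λ i → u , inB i) (allFin b)

  length-nonEdges-Γ₁ : length nonEdges-Γ₁ ≡ a + b
  length-nonEdges-Γ₁ = trans (length-++ (map _ (allFin a)))
    (cong₂ _+_ (trans (length-map _ (allFin a)) (length-allFin a)) (trans (length-map _ (allFin b)) (length-allFin b)))

  vA∈ : ∀ i → (v , inA i) ∈ nonEdges-Γ₁
  vA∈ i = ∈-++⁺ˡ (∈-map⁺ _ (∈-allFin i))
  uB∈ : ∀ i → (u , inB i) ∈ nonEdges-Γ₁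
  uB∈ i = ∈-++⁺ʳ (map _ (allFin a)) (∈-map⁺ _ (∈-allFin i))

  cover-Γ₁ : ∀ p q → p ≢ q → Graph.adj (Γ₁ a b) p q ≡ false →
    (p , q) ∈ nonEdges-Γ₁ ⊎ (q , p) ∈ nonEdges-Γ₁
  cover-Γ₁ u u p≢p _ = contradiction refl p≢p
  cover-Γ₁ u v _ ()
  cover-Γ₁ u w _ ()
  cover-Γ₁ u (inA _) _ ()
  cover-Γ₁ u (inB i) _ _ = inj₁ (uB∈ i)
  cover-Γ₁ v u _ ()
  cover-Γ₁ v v p≢p _ = contradiction refl p≢p
  cover-Γ₁ v w _ ()
  cover-Γ₁ v (inA i) _ _ = inj₁ (vA∈ i)
  cover-Γ₁ v (inB _) _ ()
  cover-Γ₁ w u _ ()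
  cover-Γ₁ w v _ ()
  cover-Γ₁ w w p≢p _ = contradiction refl p≢p
  cover-Γ₁ w (inA _) _ ()
  cover-Γ₁ w (inB _) _ ()
  cover-Γ₁ (inA _) u _ ()
  cover-Γ₁ (inA i) v _ _ = inj₂ (vA∈ i)
  cover-Γ₁ (inA _) w _ ()
  cover-Γ₁ (inA i) (inA j) p≢q adj≡false = contradiction
    (trans (sym adj≡false) (≢⇒adj (inA i) (inA j) p≢q)) λ ()
  cover-Γ₁ (inA _) (inB _) _ ()
  cover-Γ₁ (inB i) u _ _ = inj₂ (uB∈ i)
  cover-Γ₁ (inB _) v _ ()
  cover-Γ₁ (inB _) w _ ()
  cover-Γ₁ (inB _) (inA _) _ ()
  cover-Γ₁ (inB i) (inB j) p≢q adj≡false = contradiction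
    (trans (sym adj≡false) (≢⇒adj (inB i) (inB j) p≢q)) λ ()

module _ (c d : ℕ) where

  nonEdges-Γ₂ : List (Vertex 4 c d × Vertex 4 c d)
  nonEdges-Γ₂ = (w , w₁) ∷ map (λ i → v , inC i) (allFin c) ++ map (λ i → u , inD i) (allFin d)

  length-nonEdges-Γ₂ : length nonEdges-Γ₂ ≡ suc (c + d)
  length-nonEdges-Γ₂ = cong suc (trans (length-++ (map _ (allFin c)))
    (cong₂ _+_ (trans (length-map _ (allFin c)) (length-allFin c)) (trans (length-map _ (allFin d)) (length-allFin d))))

  vC∈ : ∀ i → (v , inC i) ∈ nonEdges-Γ₂
  vC∈ i = there (∈-++⁺ˡ (∈-map⁺ _ (∈-allFin i)))
  uD∈ : ∀ i → (u , inD i) ∈ nonEdges-Γ₂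
  uD∈ i = there (∈-++⁺ʳ (map _ (allFin c)) (∈-map⁺ _ (∈-allFin i)))

  cover-Γ₂ : ∀ p q → p ≢ q → Graph.adj (Γ₂ c d) p q ≡ false →
    (p , q) ∈ nonEdges-Γ₂ ⊎ (q , p) ∈ nonEdges-Γ₂
  cover-Γ₂ u u p≢p _ = contradiction refl p≢p
  cover-Γ₂ u v _ ()
  cover-Γ₂ u w _ ()
  cover-Γ₂ u w₁ _ ()
  cover-Γ₂ u (inC _) _ ()
  cover-Γ₂ u (inD i) _ _ = inj₁ (uD∈ i)
  cover-Γ₂ v u _ ()
  cover-Γ₂ v v p≢p _ = contradiction refl p≢p
  cover-Γ₂ v w _ ()
  cover-Γ₂ v w₁ _ ()
  cover-Γ₂ v (inC i) _ _ = inj₁ (vC∈ i)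
  cover-Γ₂ v (inD _) _ ()
  cover-Γ₂ w u _ ()
  cover-Γ₂ w v _ ()
  cover-Γ₂ w w p≢p _ = contradiction refl p≢p
  cover-Γ₂ w w₁ _ _ = inj₁ (here refl)
  cover-Γ₂ w (inC _) _ ()
  cover-Γ₂ w (inD _) _ ()
  cover-Γ₂ w₁ u _ ()
  cover-Γ₂ w₁ v _ ()
  cover-Γ₂ w₁ w _ _ = inj₂ (here refl)
  cover-Γ₂ w₁ w₁ p≢p _ = contradiction refl p≢p
  cover-Γ₂ w₁ (inC _) _ ()
  cover-Γ₂ w₁ (inD _) _ ()
  cover-Γ₂ (inC _) u _ ()
  cover-Γ₂ (inC i) v _ _ = inj₂ (vC∈ i)
  cover-Γ₂ (inC _) w _ ()
  cover-Γ₂ (inC _) w₁ _ ()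
  cover-Γ₂ (inC i) (inC j) p≢q adj≡false = contradiction
    (trans (sym adj≡false) (≢⇒adj (inC i) (inC j) p≢q)) λ ()
  cover-Γ₂ (inC _) (inD _) _ ()
  cover-Γ₂ (inD i) u _ _ = inj₂ (uD∈ i)
  cover-Γ₂ (inD _) v _ ()
  cover-Γ₂ (inD _) w _ ()
  cover-Γ₂ (inD _) w₁ _ ()
  cover-Γ₂ (inD _) (inC _) _ ()
  cover-Γ₂ (inD i) (inD j) p≢q adj≡false = contradiction
    (trans (sym adj≡false) (≢⇒adj (inD i) (inD j) p≢q)) λ ()

module _ {n} (G : SignedGraph (Fin n)) where

  nonEdges≤-Γ₁ : ∀ {a b N} → G ∼ negateOn N (Γ₁ a b) → length (nonEdges G) ≤ n ∸ 3
  nonEdges≤-Γ₁ {a} {b} iso = subst (length (nonEdges G) ≤_)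
    (trans (length-nonEdges-Γ₁ a b) (cong (_∸ 3) (sym (∼⇒order iso))))
    (nonEdges≤ G iso (nonEdges-Γ₁ a b) (cover-Γ₁ a b))

  nonEdges≤-Γ₂ : ∀ {c d N} → G ∼ negateOn N (Γ₂ c d) → length (nonEdges G) ≤ n ∸ 3
  nonEdges≤-Γ₂ {c} {d} iso = subst (length (nonEdges G) ≤_)
    (trans (length-nonEdges-Γ₂ c d) (cong (_∸ 3) (sym (∼⇒order iso))))
    (nonEdges≤ G iso (nonEdges-Γ₂ c d) (cover-Γ₂ c d))

  family⇒few : InFamily G → length (nonEdges G) ≤ n ∸ 3
  family⇒few (_ , _ , g₁ _ _ _     , iso) = nonEdges≤-Γ₁ iso
  family⇒few (_ , _ , g₁′          , iso) = nonEdges≤-Γ₁ iso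
  family⇒few (_ , _ , g₂ _ _ _ _ _ , iso) = nonEdges≤-Γ₂ iso
  family⇒few (_ , _ , g₃           , iso) = nonEdges≤-Γ₂ iso
  family⇒few (_ , _ , g₄           , iso) = nonEdges≤-Γ₂ iso
  family⇒few (_ , _ , g₅           , iso) = nonEdges≤-Γ₂ iso

  -- The edge bound and its equality case

  module _ (n≥7 : n ≥ 7) (unbalanced : Unbalanced G) (free : 𝒦₄⁻-Free G) where

    n≥4 : 4 ≤ n
    n≥4 = ≤-trans (s≤s (s≤s (s≤s (s≤s z≤n)))) n≥7

    few⇒negativeTriangle : length (nonEdges G) ≤ n ∸ 3 → ∃[ x ] ∃[ y ] ∃[ z ] NegativeTriangle G x y z
    few⇒negativeTriangle few with any? (λ x → any? (λ y → any? (λ z → negativeTriangle? G x y z)))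
    ... | yes found = found
    ... | no none = ⊥-elim (unbalanced (balanced n≥4 G few λ x y z t → none (x , y , z , t)))

    -- A negative triangle is guaranteed when at most `n ∸ 3` pairs are missing; otherwise the bound
    -- holds already.
    many : n ∸ 3 ≤ length (nonEdges G)
    many with ≤-total (length (nonEdges G)) (n ∸ 3)
    ... | inj₂ n∸3≤m = n∸3≤m
    ... | inj₁ few with _ , _ , _ , t ← few⇒negativeTriangle few = nonEdges≥ G free t

    few⇒family : length (nonEdges G) ≤ n ∸ 3 → InFamily G
    few⇒family few with _ , _ , _ , t ← few⇒negativeTriangle few
      with record { x = û ; y = v̂ ; z = ŵ ; extreme = extreme ; z≤y = d≤a ; y≤x = a≤b }
        ← sorted G free (extremal G free n≥4 t few) =
      classify G free extreme cA cB cD (3≤sum d≤a a≤b total) (2≤largest d≤a a≤b total) d≤a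
      where
      cA = nonNeighbours-correct G free v̂
      cB = nonNeighbours-correct G free û
      cD = nonNeighbours-correct G free ŵ
      -- Here `7 ≤ n` enters: at least four vertices lie outside the triangle.
      total : 4 ≤ codegree G free v̂ + (codegree G free û + codegree G free ŵ)
      total = +-cancelˡ-≤ 3 _ _ (≤-trans n≥7 (Signs.order≤ G free extreme cA cB cD))
      -- If the largest class had at most one vertex, the three together would have at most three.
      2≤largest : ∀ {a b d} → d ≤ a → a ≤ b → 4 ≤ a + (b + d) → 2 ≤ b
      2≤largest {a} {b} {d} d≤a a≤b 4≤ = ≮⇒≥ λ { (s≤s b≤1) → 1+n≰n (≤-trans 4≤
        (+-mono-≤ (≤-trans a≤b b≤1) (+-mono-≤ b≤1 (≤-trans d≤a (≤-trans a≤b b≤1))))) }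
      -- If `a` is zero then so is `d`, and `b` alone is at least four; otherwise `a` gives one and
      -- `b` two.
      3≤sum : ∀ {a b d} → d ≤ a → a ≤ b → 4 ≤ a + (b + d) → 3 ≤ a + b
      3≤sum {zero} {b} z≤n a≤b 4≤ = ≤-trans (n≤1+n 3) (subst (4 ≤_) (+-identityʳ b) 4≤)
      3≤sum {suc a} d≤a a≤b 4≤ = +-mono-≤ (s≤s (z≤n {a})) (2≤largest d≤a a≤b 4≤)

theorem1p5 : ∀ (n : ℕ) → n ≥ 7 → (G : SignedGraph (Fin n)) →
    Unbalanced G → 𝒦₄⁻-Free G →
    (e G ≤ n * (n ∸ 1) / 2 ∸ (n ∸ 3))
    × ((e G ≡ n * (n ∸ 1) / 2 ∸ (n ∸ 3))
    ⇔ (Σ[ W ∈ Set ] Σ[ H ∈ SignedGraph W ] (𝒢 n H × (G ∼ H))))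
theorem1p5 n n≥7 G unbalanced free = upper , mk⇔ (few⇒family G n≥7 unbalanced free ∘ few) tight
  where
  N m : ℕ
  N = n * (n ∸ 1) / 2
  m = length (nonEdges G)
  e≡ : e G ≡ N ∸ m
  e≡ = trans (sym (m+n∸n≡m (e G) m)) (cong (_∸ m) (e+nonEdges G))
  n∸3≤m : n ∸ 3 ≤ m
  n∸3≤m = many G n≥7 unbalanced free
  -- Truncated subtraction from `N` can be cancelled only for arguments up to `N`; `few` uses this
  -- for `m` and `n ∸ 3`.
  m≤N : m ≤ N
  m≤N = subst (m ≤_) (e+nonEdges G) (m≤n+m m (e G))
  upper : e G ≤ N ∸ (n ∸ 3)
  upper = subst (_≤ N ∸ (n ∸ 3)) (sym e≡) (∸-monoʳ-≤ N n∸3≤m)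
  few : e G ≡ N ∸ (n ∸ 3) → m ≤ n ∸ 3
  few eq = ≤-reflexive (∸-cancelˡ-≡ m≤N (≤-trans n∸3≤m m≤N) (trans (sym e≡) eq))
  tight : InFamily G → e G ≡ N ∸ (n ∸ 3)
  tight inFamily = trans e≡ (cong (N ∸_) (≤-antisym (family⇒few G inFamily) n∸3≤m))
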